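{- For every positive integer $n$, the optimal pegging number of the hypercube $Q_n$ satisfies \[ \left(\sqrt{5}-1\right)^n \le p(Q_n) \le (2n)^{3/2}\left(\sqrt{5}-1\right)^n. \]
   Context: $Q_n$ is the Cartesian product of $n$ copies of $K_2$, i.e. the graph on binary $n$-tuples with two tuples adjacent iff they differ in exactly one coordinate. A distribution of pegs on a graph $\Gamma$ is a subset $D \subseteq V(\Gamma)$. If $u,v \in D$ are distinct adjacent vertices and $w \notin D$ is a vertex adjacent to $v$, the pegging move (jumping $u$ over $v$ into $w$) replaces $D$ by $(D\setminus\{u,v\})\cup\{w\}$. A vertex $t$ is reachable from $D$ if some finite (possibly empty) sequence of pegging moves starting from $D$ ends in a distribution containing $t$; $\mathrm{Reach}(D)$ is the set of reachable vertices. The optimal pegging number $p(\Gamma)$ is the smallest positive integer $d$ such that some distribution of size $d$ on $\Gamma$ has reach $V(\Gamma)$. -}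

module Defs where

open import Data.Bool using (Bool; true; false; if_then_else_; _∨_; _xor_)
open import Data.Bool.Properties renaming (_≟_ to _≟ᵇ_)
open import Data.Nat using (ℕ; zero; suc; _+_; _*_; _≤_; _^_)
open import Data.Integer as ℤ using (ℤ; +_; 0ℤ)
open import Data.Vec using (Vec; []; _∷_)
open import Data.Vec.Properties using (≡-dec)
open import Data.List using (List; []; _∷_; _++_; map; length; filterᵇ)
open import Data.Product using (_×_; Σ; ∃; ∃-syntax; _,_)
open import Data.Sum using (_⊎_)
open import Relation.Nullary using (¬_)
open import Relation.Nullary.Decidable using (⌊_⌋)
open import Relation.Binary.PropositionalEquality using (_≡_; _≢_)
open import Relation.Binary.Construct.Closure.ReflexiveTransitive using (Star)

Vertex : ℕ → Set
Vertex n = Vec Bool n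

_≟V_ : ∀ {n} (x y : Vertex n) → Relation.Nullary.Dec (x ≡ y)
_≟V_ = ≡-dec _≟ᵇ_

hamming : ∀ {n} → Vertex n → Vertex n → ℕ
hamming []       []       = 0
hamming (x ∷ xs) (y ∷ ys) = (if x xor y then 1 else 0) + hamming xs ys

Adj : ∀ {n} → Vertex n → Vertex n → Set
Adj x y = hamming x y ≡ 1

allVertices : (n : ℕ) → List (Vertex n)
allVertices zero    = [] ∷ []
allVertices (suc n) = map (true ∷_) (allVertices n) ++ map (false ∷_) (allVertices n)

Distribution : ℕ → Set
Distribution n = Vertex n → Bool

size : ∀ {n} → Distribution n → ℕ
size {n} D = length (filterᵇ D (allVertices n))

jump : ∀ {n} → Distribution n → Vertex n → Vertex n → Vertex n → Distribution n
jump D u v w x =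
  if ⌊ x ≟V w ⌋ then true
  else (if ⌊ x ≟V u ⌋ ∨ ⌊ x ≟V v ⌋ then false else D x)

data Move {n : ℕ} : Distribution n → Distribution n → Set where
  move : ∀ {D} (u v w : Vertex n) →
         D u ≡ true → D v ≡ true → u ≢ v → Adj u v →
         D w ≡ false → Adj v w →
         Move D (jump D u v w)

Reachable : ∀ {n} → Distribution n → Vertex n → Set
Reachable D t = ∃[ D′ ] (Star Move D D′ × D′ t ≡ true)

ReachesAll : ∀ {n} → Distribution n → Set
ReachesAll {n} D = ∀ (t : Vertex n) → Reachable D t

IsOptimalPeggingNumber : (n d : ℕ) → Set
IsOptimalPeggingNumber n d =
  1 ≤ d
  × (∃[ D ] (size {n} D ≡ d × ReachesAll D))
  × (∀ (D : Distribution n) → 1 ≤ size D → ReachesAll D → d ≤ size D)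

record ℤ√5 : Set where
  constructor _+_√5
  field
    re : ℤ
    im : ℤ

open ℤ√5 public

infixl 7 _*√_
infixl 6 _+√_ _-√_
infixr 8 _^√_
infix 4 _≤√_

_+√_ : ℤ√5 → ℤ√5 → ℤ√5
(a + b √5) +√ (c + d √5) = (a ℤ.+ c) + (b ℤ.+ d) √5

_-√_ : ℤ√5 → ℤ√5 → ℤ√5
(a + b √5) -√ (c + d √5) = (a ℤ.- c) + (b ℤ.- d) √5

_*√_ : ℤ√5 → ℤ√5 → ℤ√5
(a + b √5) *√ (c + d √5) = (a ℤ.* c ℤ.+ + 5 ℤ.* b ℤ.* d) + (a ℤ.* d ℤ.+ b ℤ.* c) √5

_^√_ : ℤ√5 → ℕ → ℤ√5
x ^√ zero  = (+ 1) + 0ℤ √5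
x ^√ suc k = x *√ (x ^√ k)

ι : ℕ → ℤ√5
ι m = (+ m) + 0ℤ √5

√5-1 : ℤ√5
√5-1 = (ℤ.- (+ 1)) + (+ 1) √5

-- a + b√5 ≥ 0 (as a real number), decided exactly by integer inequalities
NonNeg : ℤ√5 → Set
NonNeg (a + b √5) =
    (0ℤ ℤ.≤ a × 0ℤ ℤ.≤ b)
  ⊎ (0ℤ ℤ.≤ a × b ℤ.≤ 0ℤ × + 5 ℤ.* b ℤ.* b ℤ.≤ a ℤ.* a)
  ⊎ (a ℤ.≤ 0ℤ × 0ℤ ℤ.≤ b × a ℤ.* a ℤ.≤ + 5 ℤ.* b ℤ.* b)

_≤√_ : ℤ√5 → ℤ√5 → Set
x ≤√ y = NonNeg (y -√ x)

{-# OPTIONS --safe #-}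

-- Let φ = (1 + √5)/2, so that √5 - 1 = 2/φ.
--
-- Lower bound.  As φ⁻¹ + φ⁻² = 1, the weight Σ_{x ∈ D} φ^(-d(x,t)) does not increase under a move, and it
-- is at least 1 once t carries a peg; summing over all t gives |D| φⁿ ≥ 2ⁿ.  Replacing the power φ^(n-d) by
-- the Fibonacci numbers F_{n-d+1} and F_{n-d+2} keeps the argument in ℕ, and yields that both coordinates of
-- |D| φ^(2n+2) - 2ⁿ φ^(n+2) in the basis 1, φ are nonnegative.
--
-- Upper bound.  A full subcube Q_m × {c} reaches every x ++ y with y at distance m from c, and Q_{n-m} has a
-- greedy covering by spheres of radius m; hence p · C(n-m,m) ≤ n 2ⁿ for every m.  Now C(n-m,m) counts the
-- tilings of a strip of length n with m dominoes: these numbers add up to F_{n+1}, and m has variance at most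
-- n/8 on a random tiling.  Summing the truncated parabola w² - (m - c)² with w = ⌊√n⌋ and c the mean bounds
-- p F_{n+1} by a constant times n^(3/2) 2ⁿ; the constant is good enough for n ≥ 25, and smaller n are computed.

module Submission where

open import Defs
open import Algebra.Bundles using (CommutativeSemigroup)
import Algebra.Properties.CommutativeSemigroup as CommutativeSemigroupProperties
open import Data.Bool using (Bool; true; false; if_then_else_; not; T; _xor_; _∧_; _∨_)
open import Data.Bool.Properties using (T?)
open import Data.Integer as ℤ using (ℤ; +_; -[1+_]; 0ℤ; 1ℤ; -1ℤ; +≤+; -≤+)
import Data.Integer.DivMod as ℤ
import Data.Integer.Properties as ℤ
import Data.Integer.Tactic.RingSolver as ℤSolver
open import Data.List as List using (List; []; _∷_; length)
open import Data.List.Properties using (filter-++; length-++)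
open import Data.List.Relation.Unary.Any using (Any; here; there)
open import Data.Nat
open import Data.Nat.Combinatorics using (_C_; nCn≡1; nCk≡nC[n∸k]; k>n⇒nCk≡0; nCk+nC[k+1]≡[n+1]C[k+1])
open import Data.Nat.Properties
open import Data.Nat.Tactic.RingSolver using (solve-∀)
open import Data.Product using (_×_; _,_; proj₁; proj₂; ∃-syntax)
open import Data.Sum using (_⊎_; inj₁; inj₂)
open import Data.Vec using (Vec; []; _∷_; _++_; splitAt; replicate)
open import Function using (_∘_)
open import Relation.Binary.Construct.Closure.ReflexiveTransitive using (Star; ε; _◅_; _◅◅_)
open import Relation.Binary.PropositionalEquality
open import Relation.Nullary using (yes; no; contradiction)
open import Relation.Nullary.Decidable using (⌊_⌋; toWitness)

-- Sums over the cube

-- The factor n^(3/2) has two sources: n is the logarithmic loss of the greedy covering, √n the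
-- spread of the number of dominoes. Every single C(n-m,m) is at most n 2ⁿ / p, while of the order
-- of √n of them make up a fixed share of F_{n+1}; for large n, averaging over a window thus
-- replaces any estimate of an individual binomial coefficient. The window is a parabola because its
-- untruncated sum over all tilings needs only the first two moments, and truncation at 0 can only
-- increase it. The target constant is fixed backwards from the end. As φⁿ ≤ φ F_{n+1}, and φ² = (3
-- + √5)/2 ≤ 21/8 by √5 ≤ 9/4, the bound p² ≤ 8n³ (2/φ)²ⁿ follows from 21 (p F_{n+1})² ≤ 64 n (n
-- 2ⁿ)². The upper bound is squared throughout, so that no half-integer power of 2n occurs.

∑ : ∀ {n} → (Vertex n → ℕ) → ℕ
∑ {zero}  f = f []
∑ {suc n} f = ∑ (f ∘ (true ∷_)) + ∑ (f ∘ (false ∷_))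

∑-mono : ∀ {n} {f g : Vertex n → ℕ} → (∀ x → f x ≤ g x) → ∑ f ≤ ∑ g
∑-mono {zero}  f≤g = f≤g []
∑-mono {suc n} f≤g = +-mono-≤ (∑-mono (f≤g ∘ (true ∷_))) (∑-mono (f≤g ∘ (false ∷_)))

∑-cong : ∀ {n} {f g : Vertex n → ℕ} → (∀ x → f x ≡ g x) → ∑ f ≡ ∑ g
∑-cong {zero}  f≡g = f≡g []
∑-cong {suc n} f≡g = cong₂ _+_ (∑-cong (f≡g ∘ (true ∷_))) (∑-cong (f≡g ∘ (false ∷_)))

open CommutativeSemigroupProperties +-commutativeSemigroup using () renaming (interchange to +-interchange)

∑-distrib-+ : ∀ {n} (f g : Vertex n → ℕ) → ∑ (λ x → f x + g x) ≡ ∑ f + ∑ g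
∑-distrib-+ {zero}  f g = refl
∑-distrib-+ {suc n} f g = trans
  (cong₂ _+_ (∑-distrib-+ (f ∘ (true ∷_)) (g ∘ (true ∷_)))
             (∑-distrib-+ (f ∘ (false ∷_)) (g ∘ (false ∷_))))
  (+-interchange (∑ (f ∘ (true ∷_))) _ _ _)

∑-distribˡ-* : ∀ {n} k (f : Vertex n → ℕ) → ∑ (λ x → k * f x) ≡ k * ∑ f
∑-distribˡ-* {zero}  k f = refl
∑-distribˡ-* {suc n} k f = trans
  (cong₂ _+_ (∑-distribˡ-* k (f ∘ (true ∷_))) (∑-distribˡ-* k (f ∘ (false ∷_))))
  (sym (*-distribˡ-+ k (∑ (f ∘ (true ∷_))) _))

∑-distribʳ-* : ∀ {n} k (f : Vertex n → ℕ) → ∑ (λ x → f x * k) ≡ ∑ f * k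
∑-distribʳ-* k f = trans (∑-cong (λ x → *-comm (f x) k)) (trans (∑-distribˡ-* k f) (*-comm k (∑ f)))

double : ∀ a k → a * k + a * k ≡ 2 * a * k
double = solve-∀

∑-const : ∀ n k → ∑ {n} (λ _ → k) ≡ 2 ^ n * k
∑-const zero    k = sym (+-identityʳ k)
∑-const (suc n) k = trans (cong₂ _+_ (∑-const n k) (∑-const n k)) (double (2 ^ n) k)

∑-swap : ∀ {m n} (f : Vertex m → Vertex n → ℕ) →
         ∑ (λ x → ∑ (f x)) ≡ ∑ (λ y → ∑ (λ x → f x y))
∑-swap {zero}  f = refl
∑-swap {suc m} f = trans
  (cong₂ _+_ (∑-swap (f ∘ (true ∷_))) (∑-swap (f ∘ (false ∷_))))
  (sym (∑-distrib-+ (λ y → ∑ (λ x → f (true ∷ x) y)) (λ y → ∑ (λ x → f (false ∷ x) y))))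

∑-zero : ∀ {n} {f : Vertex n → ℕ} → (∀ x → f x ≡ 0) → ∑ f ≡ 0
∑-zero {n} f≡0 = trans (∑-cong f≡0) (trans (∑-const n 0) (*-zeroʳ (2 ^ n)))

true∷≢false∷ : ∀ {n} {x y : Vertex n} → true ∷ x ≢ false ∷ y
true∷≢false∷ ()

∷-≢ : ∀ {n b} {x y : Vertex n} → x ≢ y → b ∷ x ≢ b ∷ y
∷-≢ x≢y refl = x≢y refl

∑-single : ∀ {n} (u : Vertex n) {f : Vertex n → ℕ} → (∀ x → x ≢ u → f x ≡ 0) → ∑ f ≡ f u
∑-single []          f≡0 = refl
∑-single (true ∷ u)  {f} f≡0 = trans
  (cong₂ _+_ (∑-single u (λ x x≢u → f≡0 (true ∷ x) (∷-≢ x≢u)))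
             (∑-zero (λ x → f≡0 (false ∷ x) (true∷≢false∷ ∘ sym))))
  (+-identityʳ (f (true ∷ u)))
∑-single (false ∷ u) f≡0 =
  cong₂ _+_ (∑-zero (λ x → f≡0 (true ∷ x) true∷≢false∷))
            (∑-single u (λ x x≢u → f≡0 (false ∷ x) (∷-≢ x≢u)))

𝟙 : Bool → ℕ
𝟙 b = if b then 1 else 0

𝟙≤1 : ∀ b → 𝟙 b ≤ 1
𝟙≤1 true  = ≤-refl
𝟙≤1 false = z≤n

card : ∀ {n} → (Vertex n → Bool) → ℕ
card D = ∑ (𝟙 ∘ D)

length-filterᵇ-map : ∀ {A B : Set} (P : B → Bool) (h : A → B) xs →
  length (List.filterᵇ P (List.map h xs)) ≡ length (List.filterᵇ (P ∘ h) xs)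
length-filterᵇ-map P h []       = refl
length-filterᵇ-map P h (x ∷ xs) with P (h x)
... | true  = cong suc (length-filterᵇ-map P h xs)
... | false = length-filterᵇ-map P h xs

-- Passes to recursive sums, where identities are inductions on the first coordinate instead of
-- manipulations of `allVertices`.
size≡card : ∀ {n} (D : Distribution n) → size D ≡ card D
size≡card {zero}  D with D []
... | true  = refl
... | false = refl
size≡card {suc n} D = begin
  length (List.filterᵇ D (ts List.++ fs))
    ≡⟨ cong length (filter-++ (T? ∘ D) ts fs) ⟩
  length (List.filterᵇ D ts List.++ List.filterᵇ D fs)
    ≡⟨ length-++ (List.filterᵇ D ts) ⟩
  length (List.filterᵇ D ts) + length (List.filterᵇ D fs)
    ≡⟨ cong₂ _+_ (length-filterᵇ-map D (true ∷_) (allVertices n))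
                 (length-filterᵇ-map D (false ∷_) (allVertices n)) ⟩
  size (D ∘ (true ∷_)) + size (D ∘ (false ∷_))
    ≡⟨ cong₂ _+_ (size≡card (D ∘ (true ∷_))) (size≡card (D ∘ (false ∷_))) ⟩
  card D ∎
  where
  open ≡-Reasoning
  ts = List.map (true ∷_) (allVertices n)
  fs = List.map (false ∷_) (allVertices n)

δ : ∀ {n} → Vertex n → Vertex n → ℕ
δ u x = 𝟙 ⌊ x ≟V u ⌋

∑-δ : ∀ {n} (u : Vertex n) (f : Vertex n → ℕ) → ∑ (λ x → δ u x * f x) ≡ f u
∑-δ u f = trans (∑-single u off) on
  where
  off : ∀ x → x ≢ u → δ u x * f x ≡ 0
  off x x≢u with x ≟V u
  ... | yes x≡u = contradiction x≡u x≢u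
  ... | no _    = refl
  on : δ u u * f u ≡ f u
  on with u ≟V u
  ... | yes _  = +-identityʳ (f u)
  ... | no u≢u = contradiction refl u≢u

-- The Fibonacci weight of a distribution

fib : ℕ → ℕ
fib zero          = 0
fib (suc zero)    = 1
fib (suc (suc n)) = fib (suc n) + fib n

fib-suc-≥ : ∀ n → fib n ≤ fib (suc n)
fib-suc-≥ zero    = z≤n
fib-suc-≥ (suc n) = m≤m+n (fib (suc n)) (fib n)

fib-mono : ∀ {m n} → m ≤ n → fib m ≤ fib n
fib-mono m≤n = go (≤⇒≤′ m≤n)
  where
  go : ∀ {m n} → m ≤′ n → fib m ≤ fib n
  go ≤′-refl           = ≤-refl
  go (≤′-step {n} m≤n) = ≤-trans (go m≤n) (fib-suc-≥ n)

-- The recurrence F_{k+1} = F_k + F_{k-1} plays the role of φ⁻¹ + φ⁻² = 1. The shift by one keeps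
-- all terms positive: for `fib k`, `fib a`, `fib b` themselves the case k = 1, a = b = 0 would
-- fail.
fib-jump : ∀ {k a b} → k ≤ 1 + a → k ≤ 2 + b → fib (suc k) ≤ fib (suc a) + fib (suc b)
fib-jump {zero}        {a} _ _ = ≤-trans (fib-mono (s≤s (z≤n {a}))) (m≤m+n _ _)
fib-jump {suc zero}    {a} _ _ = ≤-trans (fib-mono (s≤s (z≤n {a}))) (m≤m+n _ _)
fib-jump {suc (suc k)} (s≤s k<a) (s≤s (s≤s k≤b)) = +-mono-≤ (fib-mono (s≤s k<a)) (fib-mono (s≤s k≤b))

-- The exponent n - d(x,t), by recursion so that no truncated subtraction enters.
agree : ∀ {n} → Vertex n → Vertex n → ℕ
agree []       []       = 0
agree (x ∷ xs) (y ∷ ys) = (if x xor y then 0 else 1) + agree xs ys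

agree-refl : ∀ {n} (x : Vertex n) → agree x x ≡ n
agree-refl []           = refl
agree-refl (true  ∷ xs) = cong suc (agree-refl xs)
agree-refl (false ∷ xs) = cong suc (agree-refl xs)

agree-lipschitz : ∀ {n} (v w t : Vertex n) → agree w t ≤ hamming v w + agree v t
agree-lipschitz [] [] [] = z≤n
agree-lipschitz (a ∷ v) (b ∷ w) (c ∷ t) = ≤-trans
  (+-mono-≤ (head a b c) (agree-lipschitz v w t))
  (≤-reflexive (+-interchange (if a xor b then 1 else 0) _ _ _))
  where
  head : ∀ a b c → (if b xor c then 0 else 1) ≤ (if a xor b then 1 else 0) + (if a xor c then 0 else 1)
  head true  true  c     = ≤-refl
  head true  false true  = z≤n
  head true  false false = s≤s z≤n
  head false true  true  = s≤s z≤n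
  head false true  false = z≤n
  head false false c     = ≤-refl

-- This is Σ_j C(n,j) F_{k+j} = F_{k+2n}, the Fibonacci form of (1 + φ)ⁿ = φ²ⁿ: each coordinate of t
-- either agrees with x or not, and F_{k+1} + F_k = F_{k+2}.
∑-fib-agree : ∀ {n} k (x : Vertex n) → ∑ (λ t → fib (k + agree x t)) ≡ fib (k + 2 * n)
∑-fib-agree k [] = refl
∑-fib-agree {suc n} k (b ∷ x) = by-head b
  where
  open ≡-Reasoning
  same other : ℕ
  same  = ∑ (λ t → fib (k + suc (agree x t)))
  other = ∑ (λ t → fib (k + agree x t))
  lem : ∀ k n → 2 + (k + 2 * n) ≡ k + 2 * suc n
  lem = solve-∀
  same+other : same + other ≡ fib (k + 2 * suc n)
  same+other = begin
    same + other
      ≡⟨ cong (_+ other) (∑-cong (λ t → cong fib (+-suc k (agree x t)))) ⟩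
    ∑ (λ t → fib (suc k + agree x t)) + other
      ≡⟨ cong₂ _+_ (∑-fib-agree (suc k) x) (∑-fib-agree k x) ⟩
    fib (2 + (k + 2 * n))
      ≡⟨ cong fib (lem k n) ⟩
    fib (k + 2 * suc n) ∎
  by-head : ∀ b → ∑ (λ t → fib (k + agree (b ∷ x) t)) ≡ fib (k + 2 * suc n)
  by-head true  = same+other
  by-head false = trans (+-comm other same) same+other

weight : ∀ {n} → ℕ → Vertex n → Distribution n → ℕ
weight k t D = ∑ (λ x → 𝟙 (D x) * fib (suc k + agree x t))

true≢false : ∀ {b} → b ≡ true → b ≢ false
true≢false refl ()

weight-move : ∀ {n} k (t : Vertex n) {D D′} → Move D D′ → weight k t D′ ≤ weight k t D
weight-move {n} k t {D} (move u v w Du Dv u≢v uv Dw vw) =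
  +-cancelʳ-≤ (f w) _ _ (≤-trans (+-monoʳ-≤ (∑ F′) fw≤) sum≤)
  where
  f : Vertex n → ℕ
  f x = fib (suc k + agree x t)
  F F′ : Vertex n → ℕ
  F  x = 𝟙 (D x) * f x
  F′ x = 𝟙 (jump D u v w x) * f x
  w≤v : agree w t ≤ 1 + agree v t
  w≤v = subst (λ d → agree w t ≤ d + agree v t) vw (agree-lipschitz v w t)
  v≤u : agree v t ≤ 1 + agree u t
  v≤u = subst (λ d → agree v t ≤ d + agree u t) uv (agree-lipschitz u v t)
  fw≤ : f w ≤ f v + f u
  fw≤ = fib-jump
    (subst (k + agree w t ≤_) (+-suc k _) (+-monoʳ-≤ k w≤v))
    (subst (k + agree w t ≤_) (trans (+-suc k _) (cong suc (+-suc k _)))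
      (+-monoʳ-≤ k (≤-trans w≤v (s≤s v≤u))))
  -- The losses at u and v stand on the left and the gain at w on the right, so nothing is
  -- subtracted in ℕ.
  balance : ∀ x → F′ x + (δ v x * f x + δ u x * f x) ≤ F x + δ w x * f x
  balance x with x ≟V w | x ≟V u | x ≟V v
  ... | yes refl | yes refl | _        = contradiction Dw (true≢false Du)
  ... | yes refl | no _     | yes refl = contradiction Dw (true≢false Dv)
  ... | yes refl | no _     | no _     = ≤-trans (≤-reflexive (+-identityʳ _)) (m≤n+m _ (F x))
  ... | no _     | yes refl | yes refl = contradiction refl u≢v
  ... | no _     | yes refl | no _     rewrite Du = ≤-reflexive (sym (+-identityʳ _))
  ... | no _     | no _     | yes refl rewrite Dv = ≤-refl
  ... | no _     | no _     | no _     = ≤-refl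
  sum≤ : ∑ F′ + (f v + f u) ≤ ∑ F + f w
  sum≤ = begin
    ∑ F′ + (f v + f u)
      ≡⟨ cong (λ z → ∑ F′ + z) (cong₂ _+_ (∑-δ v f) (∑-δ u f)) ⟨
    ∑ F′ + (∑ (λ x → δ v x * f x) + ∑ (λ x → δ u x * f x))
      ≡⟨ cong (λ z → ∑ F′ + z) (∑-distrib-+ (λ x → δ v x * f x) (λ x → δ u x * f x)) ⟨
    ∑ F′ + ∑ (λ x → δ v x * f x + δ u x * f x)
      ≡⟨ ∑-distrib-+ F′ (λ x → δ v x * f x + δ u x * f x) ⟨
    ∑ (λ x → F′ x + (δ v x * f x + δ u x * f x))
      ≤⟨ ∑-mono balance ⟩
    ∑ (λ x → F x + δ w x * f x)
      ≡⟨ ∑-distrib-+ F (λ x → δ w x * f x) ⟩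
    ∑ F + ∑ (λ x → δ w x * f x)
      ≡⟨ cong (λ z → ∑ F + z) (∑-δ w f) ⟩
    ∑ F + f w ∎
    where open ≤-Reasoning

weight-star : ∀ {n} k (t : Vertex n) {D D′} → Star Move D D′ → weight k t D′ ≤ weight k t D
weight-star k t ε        = ≤-refl
weight-star k t (m ◅ ms) = ≤-trans (weight-star k t ms) (weight-move k t m)

∑-term : ∀ {n} (f : Vertex n → ℕ) u → f u ≤ ∑ f
∑-term f u = subst (_≤ ∑ f) (∑-δ u f) (∑-mono (λ x → ≤-trans (*-monoˡ-≤ (f x) (𝟙≤1 ⌊ x ≟V u ⌋)) (≤-reflexive (+-identityʳ _))))

weight-reachable : ∀ {n} k {D : Distribution n} {t} → Reachable D t → fib (suc k + n) ≤ weight k t D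
weight-reachable {n} k {D} {t} (D′ , ms , D′t) = begin
  fib (suc k + n)                         ≡⟨ cong (λ a → fib (suc k + a)) (agree-refl t) ⟨
  fib (suc k + agree t t)                 ≡⟨ +-identityʳ _ ⟨
  𝟙 true * fib (suc k + agree t t)        ≡⟨ cong (λ b → 𝟙 b * fib (suc k + agree t t)) D′t ⟨
  𝟙 (D′ t) * fib (suc k + agree t t)      ≤⟨ ∑-term (λ x → 𝟙 (D′ x) * fib (suc k + agree x t)) t ⟩
  weight k t D′                           ≤⟨ weight-star k t ms ⟩
  weight k t D                            ∎
  where open ≤-Reasoning

-- Double counting over targets and pegs: each target sees weight at least F_{k+1+n}, and each peg
-- contributes F_{k+1+2n} in total. The shift k stays free because both k = 0 and k = 1 are used.
reachesAll⇒size-bound : ∀ {n} {D : Distribution n} → ReachesAll D → ∀ k →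
  2 ^ n * fib (suc k + n) ≤ size D * fib (suc k + 2 * n)
reachesAll⇒size-bound {n} {D} reach k = begin
  2 ^ n * fib (suc k + n)
    ≡⟨ ∑-const n _ ⟨
  ∑ {n} (λ _ → fib (suc k + n))
    ≤⟨ ∑-mono (λ t → weight-reachable k (reach t)) ⟩
  ∑ (λ t → ∑ (λ x → 𝟙 (D x) * fib (suc k + agree x t)))
    ≡⟨ ∑-swap (λ t x → 𝟙 (D x) * fib (suc k + agree x t)) ⟩
  ∑ (λ x → ∑ (λ t → 𝟙 (D x) * fib (suc k + agree x t)))
    ≡⟨ ∑-cong (λ x → trans (∑-distribˡ-* (𝟙 (D x)) (λ t → fib (suc k + agree x t)))
                           (cong (𝟙 (D x) *_) (∑-fib-agree (suc k) x))) ⟩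
  ∑ (λ x → 𝟙 (D x) * fib (suc k + 2 * n))
    ≡⟨ ∑-distribʳ-* _ (𝟙 ∘ D) ⟩
  card D * fib (suc k + 2 * n)
    ≡⟨ cong (_* fib (suc k + 2 * n)) (size≡card D) ⟨
  size D * fib (suc k + 2 * n) ∎
  where open ≤-Reasoning

-- Moves from a full subcube

hamming-refl : ∀ {n} (x : Vertex n) → hamming x x ≡ 0
hamming-refl []          = refl
hamming-refl (true ∷ x)  = hamming-refl x
hamming-refl (false ∷ x) = hamming-refl x

hamming≡0⇒≡ : ∀ {n} (x y : Vertex n) → hamming x y ≡ 0 → x ≡ y
hamming≡0⇒≡ []          []          _ = refl
hamming≡0⇒≡ (true ∷ x)  (true ∷ y)  d = cong (true ∷_) (hamming≡0⇒≡ x y d)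
hamming≡0⇒≡ (false ∷ x) (false ∷ y) d = cong (false ∷_) (hamming≡0⇒≡ x y d)

hamming-∷ : ∀ {n} b (x y : Vertex n) → hamming (b ∷ x) (b ∷ y) ≡ hamming x y
hamming-∷ true  x y = refl
hamming-∷ false x y = refl

hamming-++ : ∀ {m n} (x : Vertex m) (y z : Vertex n) → hamming (x ++ y) (x ++ z) ≡ hamming y z
hamming-++ []      y z = refl
hamming-++ (b ∷ x) y z = trans (hamming-∷ b (x ++ y) (x ++ z)) (hamming-++ x y z)

hamming-flip : ∀ {n} b (x : Vertex n) → hamming (not b ∷ x) (b ∷ x) ≡ 1
hamming-flip true  x = cong suc (hamming-refl x)
hamming-flip false x = cong suc (hamming-refl x)

step-towards : ∀ {n m} (c y : Vertex n) → hamming c y ≡ suc m →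
               ∃[ y′ ] (hamming c y′ ≡ m × Adj y′ y)
step-towards []          []          ()
step-towards (true ∷ c)  (false ∷ y) d = true ∷ y , suc-injective d , cong suc (hamming-refl y)
step-towards (false ∷ c) (true ∷ y)  d = false ∷ y , suc-injective d , cong suc (hamming-refl y)
step-towards (true ∷ c)  (true ∷ y)  d = let y′ , d′ , a = step-towards c y d in true ∷ y′ , d′ , a
step-towards (false ∷ c) (false ∷ y) d = let y′ , d′ , a = step-towards c y d in false ∷ y′ , d′ , a

infix 4 _⊑_
_⊑_ : ∀ {n} → Distribution n → Distribution n → Set
D ⊑ E = ∀ x → D x ≡ true → E x ≡ true

facet : ∀ {n} → Bool → Distribution (suc n) → Distribution n
facet b D x = D (b ∷ x)

module _ {n : ℕ} (D : Distribution n) (u v w : Vertex n) where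

  jump-target : jump D u v w w ≡ true
  jump-target with w ≟V w
  ... | yes _  = refl
  ... | no w≢w = contradiction refl w≢w

  jump-keeps : ∀ x → x ≢ u → x ≢ v → D x ≡ true → jump D u v w x ≡ true
  jump-keeps x x≢u x≢v Dx with x ≟V w | x ≟V u | x ≟V v
  ... | yes _ | _       | _       = refl
  ... | no _  | yes x≡u | _       = contradiction x≡u x≢u
  ... | no _  | no _    | yes x≡v = contradiction x≡v x≢v
  ... | no _  | no _    | no _    = Dx

  jump-elim : ∀ x → jump D u v w x ≡ true → x ≡ w ⊎ (x ≢ u × x ≢ v × D x ≡ true)
  jump-elim x Jx with x ≟V w | x ≟V u | x ≟V v
  ... | yes x≡w | _      | _      = inj₁ x≡w
  ... | no _    | no x≢u | no x≢v = inj₂ (x≢u , x≢v , Jx)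

not-∷-≢ : ∀ {n} b {x y : Vertex n} → not b ∷ x ≢ b ∷ y
not-∷-≢ true  ()
not-∷-≢ false ()

FacetExtension : ∀ {n} → Bool → Distribution n → Distribution (suc n) → Set
FacetExtension b E D̂ = ∃[ Ê ] (Star Move D̂ Ê × E ⊑ facet b Ê × facet (not b) D̂ ⊑ facet (not b) Ê)

∷-injective : ∀ {n b} {x y : Vertex n} → b ∷ x ≡ b ∷ y → x ≡ y
∷-injective refl = refl

-- Additional pegs do no harm: if the landing vertex is already occupied in `D̂`, the move is
-- skipped, and otherwise it is carried out. In both cases the opposite facet keeps all its pegs.
move-in-facet : ∀ {n} b {D E : Distribution n} → Move D E →
                ∀ D̂ → D ⊑ facet b D̂ → FacetExtension b E D̂
move-in-facet b {D} (move u v w Du Dv u≢v uv Dw vw) D̂ D⊑ with D̂ (b ∷ w) in D̂w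
... | true  = D̂ , ε , E⊑ , λ _ Dx → Dx
  where
  E⊑ : jump D u v w ⊑ facet b D̂
  E⊑ x Jx with jump-elim D u v w x Jx
  ... | inj₁ refl          = D̂w
  ... | inj₂ (_ , _ , Dx) = D⊑ x Dx
... | false = jump D̂ (b ∷ u) (b ∷ v) (b ∷ w) , m̂ ◅ ε , E⊑ , other⊑
  where
  m̂ = move (b ∷ u) (b ∷ v) (b ∷ w) (D⊑ u Du) (D⊑ v Dv) (u≢v ∘ ∷-injective)
           (trans (hamming-∷ b u v) uv) D̂w (trans (hamming-∷ b v w) vw)
  E⊑ : jump D u v w ⊑ facet b (jump D̂ (b ∷ u) (b ∷ v) (b ∷ w))
  E⊑ x Jx with jump-elim D u v w x Jx
  ... | inj₁ refl               = jump-target D̂ (b ∷ u) (b ∷ v) (b ∷ w)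
  ... | inj₂ (x≢u , x≢v , Dx) =
    jump-keeps D̂ (b ∷ u) (b ∷ v) (b ∷ w) (b ∷ x) (x≢u ∘ ∷-injective) (x≢v ∘ ∷-injective) (D⊑ x Dx)
  other⊑ : facet (not b) D̂ ⊑ facet (not b) (jump D̂ (b ∷ u) (b ∷ v) (b ∷ w))
  other⊑ x = jump-keeps D̂ (b ∷ u) (b ∷ v) (b ∷ w) (not b ∷ x) (not-∷-≢ b) (not-∷-≢ b)

moves-in-facet : ∀ {n} b {D E : Distribution n} → Star Move D E →
                 ∀ D̂ → D ⊑ facet b D̂ → FacetExtension b E D̂
moves-in-facet b ε        D̂ D⊑ = D̂ , ε , D⊑ , λ _ Dx → Dx
moves-in-facet b (m ◅ ms) D̂ D⊑ =
  let D₁ , ms₁ , in₁ , out₁ = move-in-facet b m D̂ D⊑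
      D₂ , ms₂ , in₂ , out₂ = moves-in-facet b ms D₁ in₁
  in D₂ , ms₁ ◅◅ ms₂ , in₂ , λ x → out₂ x ∘ out₁ x

-- A target x ++ y is jumped into from the two vertices one step closer to c whose first
-- coordinates differ; each is prepared inside its own facet, so the two preparations do not interfere.
subcube-reach : ∀ m {N} (D : Distribution (m + N)) (c y : Vertex N) →
                (∀ x → D (x ++ c) ≡ true) → hamming c y ≡ m →
                ∀ (x : Vertex m) → Reachable D (x ++ y)
subcube-reach zero D c y full d [] = D , ε , subst (λ z → D z ≡ true) (hamming≡0⇒≡ c y d) (full [])
subcube-reach (suc m) D c y full d (b ∷ x) = conclude (D₂ (b ∷ x ++ y)) refl
  where
  closer = step-towards c y d
  y′ = proj₁ closer
  v-ready = subcube-reach m (facet b D) c y′ (full ∘ (b ∷_)) (proj₁ (proj₂ closer)) x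
  v-lifted = moves-in-facet b (proj₁ (proj₂ v-ready)) D (λ _ Dx → Dx)
  D₁ = proj₁ v-lifted
  u-ready = subcube-reach m (facet (not b) D) c y′ (full ∘ (not b ∷_)) (proj₁ (proj₂ closer)) x
  u-lifted = moves-in-facet (not b) (proj₁ (proj₂ u-ready)) D₁ (proj₂ (proj₂ (proj₂ v-lifted)))
  D₂ = proj₁ u-lifted
  ms : Star Move D D₂
  ms = proj₁ (proj₂ v-lifted) ◅◅ proj₁ (proj₂ u-lifted)
  u v t : Vertex (suc m + _)
  u = not b ∷ x ++ y′
  v = b ∷ x ++ y′
  t = b ∷ x ++ y
  D₂u : D₂ u ≡ true
  D₂u = proj₁ (proj₂ (proj₂ u-lifted)) _ (proj₂ (proj₂ u-ready))
  not-not : ∀ b → not (not b) ≡ b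
  not-not true  = refl
  not-not false = refl
  D₂v : D₂ v ≡ true
  D₂v = subst (λ b′ → D₁ (b′ ∷ x ++ y′) ≡ true → D₂ (b′ ∷ x ++ y′) ≡ true) (not-not b)
          (proj₂ (proj₂ (proj₂ u-lifted)) (x ++ y′))
          (proj₁ (proj₂ (proj₂ v-lifted)) _ (proj₂ (proj₂ v-ready)))
  -- A jump must land on an empty vertex; if the preparations have left a peg on `t`, nothing
  -- remains to be done.
  conclude : ∀ b′ → D₂ t ≡ b′ → Reachable D t
  conclude true  D₂t = D₂ , ms , D₂t
  conclude false D₂t =
    jump D₂ u v t ,
    ms ◅◅ move u v t D₂u D₂v (not-∷-≢ b) (hamming-flip b (x ++ y′)) D₂t
               (trans (hamming-∷ b (x ++ y′) (x ++ y)) (trans (hamming-++ x y′ y) (proj₂ (proj₂ closer)))) ◅ ε ,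
    jump-target D₂ u v t

-- Greedy coverings

nC0≡1 : ∀ n → n C 0 ≡ 1
nC0≡1 n = trans (nCk≡nC[n∸k] {0} {n} z≤n) (nCn≡1 n)

onSphere : ∀ {n} → ℕ → Vertex n → Vertex n → Bool
onSphere m c y = hamming c y ≡ᵇ m

card-sphere : ∀ {n} m (y : Vertex n) → ∑ (λ c → 𝟙 (onSphere m c y)) ≡ n C m
card-sphere zero    [] = refl
card-sphere (suc m) [] = sym (k>n⇒nCk≡0 (s≤s (z≤n {m})))
card-sphere {suc n} m (b ∷ y) = by-head b
  where
  same other : ∀ m → ℕ
  same m  = ∑ (λ c → 𝟙 (onSphere m c y))
  other m = ∑ (λ c → 𝟙 (suc (hamming c y) ≡ᵇ m))
  other+same : ∀ m → other m + ∑ (λ c → 𝟙 (onSphere m c y)) ≡ suc n C m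
  other+same zero = trans (cong₂ _+_ (∑-zero {f = λ c → 𝟙 (suc (hamming c y) ≡ᵇ 0)} (λ _ → refl)) (card-sphere 0 y))
                          (trans (nC0≡1 n) (sym (nC0≡1 (suc n))))
  other+same (suc m) = trans (cong₂ _+_ (card-sphere m y) (card-sphere (suc m) y)) (nCk+nC[k+1]≡[n+1]C[k+1] n m)
  by-head : ∀ b → ∑ (λ c → 𝟙 (onSphere m c (b ∷ y))) ≡ suc n C m
  by-head true  = trans (+-comm (same m) (other m)) (other+same m)
  by-head false = other+same m

above-average : ∀ {n} (f : Vertex n → ℕ) → ∃[ c ] ∑ f ≤ 2 ^ n * f c
above-average {zero}  f = [] , ≤-reflexive (sym (+-identityʳ (f [])))
above-average {suc n} f = choose (≤-total (f (true ∷ a)) (f (false ∷ b)))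
  where
  a = proj₁ (above-average (f ∘ (true ∷_)))
  b = proj₁ (above-average (f ∘ (false ∷_)))
  bound : ∀ {z} → f (true ∷ a) ≤ z → f (false ∷ b) ≤ z → ∑ f ≤ 2 ^ suc n * z
  bound {z} fa≤z fb≤z = ≤-trans
    (+-mono-≤ (≤-trans (proj₂ (above-average (f ∘ (true ∷_)))) (*-monoʳ-≤ (2 ^ n) fa≤z))
              (≤-trans (proj₂ (above-average (f ∘ (false ∷_)))) (*-monoʳ-≤ (2 ^ n) fb≤z)))
    (≤-reflexive (double (2 ^ n) z))
  choose : f (true ∷ a) ≤ f (false ∷ b) ⊎ f (false ∷ b) ≤ f (true ∷ a) → ∃[ c ] ∑ f ≤ 2 ^ suc n * f c
  choose (inj₁ fa≤fb) = false ∷ b , bound fa≤fb ≤-refl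
  choose (inj₂ fb≤fa) = true ∷ a  , bound ≤-refl fb≤fa

card-pos : ∀ {n} (U : Vertex n → Bool) {y} → U y ≡ true → 1 ≤ card U
card-pos U {y} Uy = subst (_≤ card U) (cong 𝟙 Uy) (∑-term (𝟙 ∘ U) y)

module Covering {n : ℕ} (covers : Vertex n → Vertex n → Bool) (V : ℕ) .{{_ : NonZero V}}
                (degree : ∀ y → ∑ (λ c → 𝟙 (covers c y)) ≡ V) where

  CoveredBy : (Vertex n → Bool) → List (Vertex n) → Set
  CoveredBy U cs = ∀ y → U y ≡ true → Any (λ c → covers c y ≡ true) cs

  gain : (Vertex n → Bool) → Vertex n → ℕ
  gain U c = ∑ (λ y → 𝟙 (covers c y) * 𝟙 (U y))

  -- Double counting of pairs of a centre and an uncovered point. With `above-average` it yields a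
  -- centre covering at least the fraction V/2ⁿ of `U`.
  ∑-gain : ∀ U → ∑ (gain U) ≡ V * card U
  ∑-gain U = begin
    ∑ (λ c → ∑ (λ y → 𝟙 (covers c y) * 𝟙 (U y)))
      ≡⟨ ∑-swap (λ c y → 𝟙 (covers c y) * 𝟙 (U y)) ⟩
    ∑ (λ y → ∑ (λ c → 𝟙 (covers c y) * 𝟙 (U y)))
      ≡⟨ ∑-cong (λ y → trans (∑-distribʳ-* (𝟙 (U y)) (λ c → 𝟙 (covers c y))) (cong (_* 𝟙 (U y)) (degree y))) ⟩
    ∑ (λ y → V * 𝟙 (U y))
      ≡⟨ ∑-distribˡ-* V (𝟙 ∘ U) ⟩
    V * card U ∎
    where open ≡-Reasoning

  remove : Vertex n → (Vertex n → Bool) → (Vertex n → Bool)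
  remove c U y = U y ∧ not (covers c y)

  card-remove : ∀ c U → gain U c + card (remove c U) ≡ card U
  card-remove c U = trans
    (sym (∑-distrib-+ (λ y → 𝟙 (covers c y) * 𝟙 (U y)) (𝟙 ∘ remove c U)))
    (∑-cong (λ y → split (covers c y) (U y)))
    where
    split : ∀ a b → 𝟙 a * 𝟙 b + 𝟙 (b ∧ not a) ≡ 𝟙 b
    split true  true  = refl
    split true  false = refl
    split false true  = refl
    split false false = refl

  -- The bound V·K/2ⁿ ≤ k + u/2ᵏ, for every k, says that K is at most 2ⁿ/V times the concave
  -- piecewise linear function of u interpolating 1 + log₂ u at the powers of two, given by its tangents.
  SmallCover : (Vertex n → Bool) → Set
  SmallCover U = ∃[ cs ] (CoveredBy U cs ×
    (∀ k → V * length cs * 2 ^ k ≤ (k * 2 ^ k + card U) * 2 ^ n))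

  covered-cons : ∀ c U cs → CoveredBy (remove c U) cs → CoveredBy U (c ∷ cs)
  covered-cons c U cs cov y Uy with covers c y in cy
  ... | true  = here cy
  ... | false = there (cov y (trans (cong₂ (λ a b → a ∧ not b) Uy cy) refl))

  -- Put s = V/2ⁿ. The new centre adds s to the left side, and the right side k + u/2ᵏ has dropped
  -- by at least s u/2ᵏ, which pays for it when 2ᵏ ≤ u. When 2ᵏ > u, the bound for k - 1 is the
  -- stronger one, since (k - 1) + 2u/2ᵏ ≤ k + u/2ᵏ; descending in k ends at the latest at k = 0,
  -- where u ≥ 1.
  cover-step : ∀ c U → 1 ≤ card U → V * card U ≤ 2 ^ n * gain U c → SmallCover (remove c U) → SmallCover U
  cover-step c U 1≤u Vu≤ (cs , cov , small) = c ∷ cs , covered-cons c U cs cov , bound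
    where
    u u′ : ℕ
    u  = card U
    u′ = card (remove c U)
    dense : ∀ k → 2 ^ k ≤ u → V * suc (length cs) * 2 ^ k ≤ (k * 2 ^ k + u) * 2 ^ n
    dense k 2^k≤u = begin
      V * suc (length cs) * 2 ^ k
        ≡⟨ lem₁ V (length cs) (2 ^ k) ⟩
      V * 2 ^ k + V * length cs * 2 ^ k
        ≤⟨ +-mono-≤ (≤-trans (*-monoʳ-≤ V 2^k≤u) Vu≤) (small k) ⟩
      2 ^ n * gain U c + (k * 2 ^ k + u′) * 2 ^ n
        ≡⟨ lem₂ (2 ^ n) (gain U c) (k * 2 ^ k) u′ ⟩
      (k * 2 ^ k + (gain U c + u′)) * 2 ^ n
        ≡⟨ cong (λ z → (k * 2 ^ k + z) * 2 ^ n) (card-remove c U) ⟩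
      (k * 2 ^ k + u) * 2 ^ n ∎
      where
      open ≤-Reasoning
      lem₁ : ∀ V l p → V * suc l * p ≡ V * p + V * l * p
      lem₁ = solve-∀
      lem₂ : ∀ q g a u → q * g + (a + u) * q ≡ (a + (g + u)) * q
      lem₂ = solve-∀
    bound : ∀ k → V * suc (length cs) * 2 ^ k ≤ (k * 2 ^ k + u) * 2 ^ n
    bound zero = dense 0 1≤u
    bound (suc k) with 2 ^ suc k ≤? u
    ... | yes 2^k≤u = dense (suc k) 2^k≤u
    ... | no  2^k≰u = begin
      V * suc (length cs) * 2 ^ suc k
        ≡⟨ lem₁ (V * suc (length cs)) (2 ^ k) ⟩
      2 * (V * suc (length cs) * 2 ^ k)
        ≤⟨ *-monoʳ-≤ 2 (bound k) ⟩
      2 * ((k * 2 ^ k + u) * 2 ^ n)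
        ≡⟨ lem₂ k (2 ^ k) u (2 ^ n) ⟩
      (k * 2 ^ suc k + u + u) * 2 ^ n
        ≤⟨ *-monoˡ-≤ (2 ^ n) (+-monoˡ-≤ u (+-monoʳ-≤ (k * 2 ^ suc k) (<⇒≤ (≰⇒> 2^k≰u)))) ⟩
      (k * 2 ^ suc k + 2 ^ suc k + u) * 2 ^ n
        ≡⟨ cong (λ z → (z + u) * 2 ^ n) (+-comm (k * 2 ^ suc k) (2 ^ suc k)) ⟩
      (suc k * 2 ^ suc k + u) * 2 ^ n ∎
      where
      open ≤-Reasoning
      lem₁ : ∀ a p → a * (2 * p) ≡ 2 * (a * p)
      lem₁ = solve-∀
      lem₂ : ∀ k p u q → 2 * ((k * p + u) * q) ≡ (k * (2 * p) + u + u) * q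
      lem₂ = solve-∀

  empty-cover : ∀ U → card U ≡ 0 → SmallCover U
  empty-cover U u≡0 = [] ,
    (λ y Uy → contradiction (subst (1 ≤_) u≡0 (card-pos U Uy)) λ ()) ,
    (λ k → subst (_≤ (k * 2 ^ k + card U) * 2 ^ n) (sym (cong (_* 2 ^ k) (*-zeroʳ V))) z≤n)

  greedy : ∀ fuel U → card U ≤ fuel → SmallCover U
  greedy zero       U u≤ = empty-cover U (n≤0⇒n≡0 u≤)
  greedy (suc fuel) U u≤ with card U ≟ 0
  ... | yes u≡0 = empty-cover U u≡0
  ... | no  u≢0 = cover-step c U 1≤u Vu≤ (greedy fuel (remove c U) (≤-pred (≤-trans shrinks u≤)))
    where
    c = proj₁ (above-average (gain U))
    1≤u : 1 ≤ card U
    1≤u = n≢0⇒n>0 u≢0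
    Vu≤ : V * card U ≤ 2 ^ n * gain U c
    Vu≤ = subst (_≤ 2 ^ n * gain U c) (∑-gain U) (proj₂ (above-average (gain U)))
    -- Progress: `V` and `card U` are positive, hence so is the average gain, and the fuel suffices.
    1≤gain : 1 ≤ gain U c
    1≤gain with gain U c in g≡
    ... | suc _ = s≤s z≤n
    ... | zero  = contradiction
      (≤-trans (*-mono-≤ (>-nonZero⁻¹ V) 1≤u) (≤-trans Vu≤ (≤-reflexive (trans (cong (2 ^ n *_) g≡) (*-zeroʳ (2 ^ n))))))
      λ ()
    shrinks : suc (card (remove c U)) ≤ card U
    shrinks = ≤-trans (+-monoˡ-≤ (card (remove c U)) 1≤gain) (≤-reflexive (card-remove c U))

  -- At u = 2ⁿ the tangent k = n is the one that touches: its bound is n + 1 = 1 + log₂ u.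
  exists-cover : ∃[ cs ] ((∀ y → Any (λ c → covers c y ≡ true) cs) × V * length cs ≤ suc n * 2 ^ n)
  exists-cover =
    let cs , cov , small = greedy (card everything) everything ≤-refl
    in cs , (λ y → cov y refl) ,
       *-cancelʳ-≤ (V * length cs) (suc n * 2 ^ n) (2 ^ n) {{m^n≢0 2 n}}
         (≤-trans (small n) (≤-reflexive (cong (_* 2 ^ n)
           (trans (cong (λ z → n * 2 ^ n + z) (trans (∑-const n 1) (*-identityʳ (2 ^ n)))) (+-comm (n * 2 ^ n) (2 ^ n))))))
    where
    everything : Vertex n → Bool
    everything _ = true

-- Distributions from coverings

cylinder : ∀ m {n} → (Vertex n → Bool) → Distribution (m + n)
cylinder zero    S x       = S x
cylinder (suc m) S (_ ∷ x) = cylinder m S x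

card-cylinder : ∀ m {n} (S : Vertex n → Bool) → card (cylinder m S) ≡ 2 ^ m * card S
card-cylinder zero    S = sym (+-identityʳ (card S))
card-cylinder (suc m) S = trans (cong₂ _+_ (card-cylinder m S) (card-cylinder m S)) (double (2 ^ m) (card S))

cylinder-++ : ∀ {m n} (S : Vertex n → Bool) (x : Vertex m) y → cylinder m S (x ++ y) ≡ S y
cylinder-++ S []      y = refl
cylinder-++ S (_ ∷ x) y = cylinder-++ S x y

member : ∀ {n} → List (Vertex n) → Vertex n → Bool
member []       x = false
member (c ∷ cs) x = ⌊ x ≟V c ⌋ ∨ member cs x

card-member : ∀ {n} (cs : List (Vertex n)) → card (member cs) ≤ length cs
card-member {n} []   = ≤-reflexive (∑-zero {n} {λ _ → 0} (λ _ → refl))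
card-member (c ∷ cs) = begin
  card (member (c ∷ cs))
    ≤⟨ ∑-mono (λ x → 𝟙-∨ ⌊ x ≟V c ⌋ (member cs x)) ⟩
  ∑ (λ x → δ c x * 1 + 𝟙 (member cs x))
    ≡⟨ ∑-distrib-+ (λ x → δ c x * 1) (𝟙 ∘ member cs) ⟩
  ∑ (λ x → δ c x * 1) + card (member cs)
    ≤⟨ +-mono-≤ (≤-reflexive (∑-δ c (λ _ → 1))) (card-member cs) ⟩
  suc (length cs) ∎
  where
  open ≤-Reasoning
  𝟙-∨ : ∀ a b → 𝟙 (a ∨ b) ≤ 𝟙 a * 1 + 𝟙 b
  𝟙-∨ true  b = s≤s z≤n
  𝟙-∨ false b = ≤-refl

covering-center : ∀ {n} {P : Vertex n → Set} {cs} → Any P cs → ∃[ c ] (member cs c ≡ true × P c)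
covering-center {cs = c ∷ cs} (here Pc) with c ≟V c in eq
... | yes _  = c , cong (λ d → ⌊ d ⌋ ∨ member cs c) eq , Pc
... | no c≢c = contradiction refl c≢c
covering-center {cs = c′ ∷ cs} (there any) with covering-center any
... | c , c∈ , Pc = c , trans (cong (⌊ c ≟V c′ ⌋ ∨_) c∈) (∨-true ⌊ c ≟V c′ ⌋) , Pc
  where
  ∨-true : ∀ b → b ∨ true ≡ true
  ∨-true true  = refl
  ∨-true false = refl

optimal-≤-subcubes : ∀ m N {p} → IsOptimalPeggingNumber (m + N) p → p * (N C m) ≤ suc N * 2 ^ (m + N)
optimal-≤-subcubes m N {p} (_ , _ , minimal) with N C m in V≡
... | zero  = subst (_≤ suc N * 2 ^ (m + N)) (sym (*-zeroʳ p)) z≤n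
... | V@(suc _) = begin
  p * V
    ≤⟨ *-monoˡ-≤ V p≤ ⟩
  2 ^ m * length cs * V
    ≡⟨ lem₁ (2 ^ m) (length cs) V ⟩
  2 ^ m * (V * length cs)
    ≤⟨ *-monoʳ-≤ (2 ^ m) (proj₂ (proj₂ cover)) ⟩
  2 ^ m * (suc N * 2 ^ N)
    ≡⟨ lem₂ (2 ^ m) (suc N) (2 ^ N) ⟩
  suc N * (2 ^ m * 2 ^ N)
    ≡⟨ cong (suc N *_) (^-distribˡ-+-* 2 m N) ⟨
  suc N * 2 ^ (m + N) ∎
  where
  open ≤-Reasoning
  lem₁ : ∀ a b c → a * b * c ≡ a * (c * b)
  lem₁ = solve-∀
  lem₂ : ∀ a b c → a * (b * c) ≡ b * (a * c)
  lem₂ = solve-∀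
  open Covering (onSphere m) V (λ y → trans (card-sphere m y) V≡)
  cover = exists-cover
  cs = proj₁ cover
  D : Distribution (m + N)
  D = cylinder m (member cs)
  center : ∀ y → ∃[ c ] (member cs c ≡ true × onSphere m c y ≡ true)
  center y = covering-center (proj₁ (proj₂ cover) y)
  reaches : ReachesAll D
  reaches t with splitAt m t
  ... | x , y , refl =
    let c , c∈ , cy = center y
    in subcube-reach m D c y (λ z → trans (cylinder-++ (member cs) z c) c∈)
         (≡ᵇ⇒≡ (hamming c y) m (subst T (sym cy) _)) x
  1≤size : 1 ≤ size D
  1≤size = let c , c∈ , _ = center (replicate N true) in
    subst (1 ≤_) (sym (size≡card D))
      (card-pos D {replicate m true ++ c} (trans (cylinder-++ (member cs) (replicate m true) c) c∈))
  p≤ : p ≤ 2 ^ m * length cs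
  p≤ = ≤-trans (minimal D 1≤size reaches) (≤-trans
    (≤-reflexive (trans (size≡card D) (card-cylinder m (member cs))))
    (*-monoʳ-≤ (2 ^ m) (card-member cs)))

optimal-≤-2^n : ∀ {n p} → IsOptimalPeggingNumber n p → p ≤ 2 ^ n
optimal-≤-2^n {n} (_ , _ , minimal) = subst (_ ≤_) size-full
  (minimal full (subst (1 ≤_) (sym size-full) (m^n>0 2 n)) (λ t → full , ε , refl))
  where
  full : Distribution n
  full _ = true
  size-full : size full ≡ 2 ^ n
  size-full = trans (size≡card full) (trans (∑-const n 1) (*-identityʳ (2 ^ n)))

-- The covering of Q_{n-m} loses a factor n - m + 1, which is at most n only for m ≥ 1. For m = 0
-- the distribution with a peg on every vertex is used instead.
optimal-≤-tilings : ∀ {n p} m → 1 ≤ n → m ≤ n → IsOptimalPeggingNumber n p → p * ((n ∸ m) C m) ≤ n * 2 ^ n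
optimal-≤-tilings {n@(suc _)} {p} zero _ _ opt = begin
  p * (n C 0)   ≡⟨ cong (p *_) (nC0≡1 n) ⟩
  p * 1         ≡⟨ *-identityʳ p ⟩
  p             ≤⟨ optimal-≤-2^n opt ⟩
  2 ^ n         ≤⟨ m≤n*m (2 ^ n) n ⟩
  n * 2 ^ n     ∎
  where open ≤-Reasoning
optimal-≤-tilings {n} {p} m@(suc k) _ m≤n opt = begin
  p * ((n ∸ m) C m)
    ≤⟨ optimal-≤-subcubes m (n ∸ m) (subst (λ d → IsOptimalPeggingNumber d p) (sym m+N≡n) opt) ⟩
  suc (n ∸ m) * 2 ^ (m + (n ∸ m))
    ≡⟨ cong (λ d → suc (n ∸ m) * 2 ^ d) m+N≡n ⟩
  suc (n ∸ m) * 2 ^ n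
    ≤⟨ *-monoˡ-≤ (2 ^ n) (≤-trans (+-monoˡ-≤ (n ∸ m) (s≤s (z≤n {k}))) (≤-reflexive m+N≡n)) ⟩
  n * 2 ^ n ∎
  where
  open ≤-Reasoning
  m+N≡n : m + (n ∸ m) ≡ n
  m+N≡n = m+[n∸m]≡n m≤n

-- Domino tilings

-- The sum of f over the tilings of a strip of length n by squares and dominoes, f being applied to the number of dominoes.
tilings : ℕ → (ℕ → ℤ) → ℤ
tilings zero          f = f 0
tilings (suc zero)    f = f 0
tilings (suc (suc n)) f = tilings (suc n) f ℤ.+ tilings n (f ∘ suc)

tilings-cong : ∀ n {f g} → (∀ m → f m ≡ g m) → tilings n f ≡ tilings n g
tilings-cong zero          f≡g = f≡g 0
tilings-cong (suc zero)    f≡g = f≡g 0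
tilings-cong (suc (suc n)) f≡g = cong₂ ℤ._+_ (tilings-cong (suc n) f≡g) (tilings-cong n (f≡g ∘ suc))

tilings-mono : ∀ n {f g} → (∀ m → f m ℤ.≤ g m) → tilings n f ℤ.≤ tilings n g
tilings-mono zero          f≤g = f≤g 0
tilings-mono (suc zero)    f≤g = f≤g 0
tilings-mono (suc (suc n)) f≤g = ℤ.+-mono-≤ (tilings-mono (suc n) f≤g) (tilings-mono n (f≤g ∘ suc))

tilings-linear : ∀ n a f b g → tilings n (λ m → a ℤ.* f m ℤ.+ b ℤ.* g m) ≡ a ℤ.* tilings n f ℤ.+ b ℤ.* tilings n g
tilings-linear zero          a f b g = refl
tilings-linear (suc zero)    a f b g = refl
tilings-linear (suc (suc n)) a f b g = trans
  (cong₂ ℤ._+_ (tilings-linear (suc n) a f b g) (tilings-linear n a (f ∘ suc) b (g ∘ suc)))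
  (lem a (tilings (suc n) f) (tilings n (f ∘ suc)) b (tilings (suc n) g) (tilings n (g ∘ suc)))
  where
  lem : ∀ a x x′ b y y′ → (a ℤ.* x ℤ.+ b ℤ.* y) ℤ.+ (a ℤ.* x′ ℤ.+ b ℤ.* y′) ≡ a ℤ.* (x ℤ.+ x′) ℤ.+ b ℤ.* (y ℤ.+ y′)
  lem = ℤSolver.solve-∀

tilings-zero : ∀ n → tilings n (λ _ → 0ℤ) ≡ 0ℤ
tilings-zero n = tilings-linear n 0ℤ (λ _ → 0ℤ) 0ℤ (λ _ → 0ℤ)

-- Moments of the number of dominoes

one count count² : ℕ → ℤ
one    m = 1ℤ
count  m = + m
count² m = + m ℤ.* + m

tilings-one : ∀ n → tilings n one ≡ + fib (suc n)
tilings-one zero          = refl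
tilings-one (suc zero)    = refl
tilings-one (suc (suc n)) = cong₂ ℤ._+_ (tilings-one (suc n)) (tilings-one n)

count-step : ∀ n → tilings (2 + n) count ≡ tilings (1 + n) count ℤ.+ (tilings n count ℤ.+ + fib (suc n))
count-step n = cong (λ z → tilings (1 + n) count ℤ.+ z) (begin
  tilings n (count ∘ suc)
    ≡⟨ tilings-cong n (λ m → lem (+ m)) ⟩
  tilings n (λ m → 1ℤ ℤ.* count m ℤ.+ 1ℤ ℤ.* one m)
    ≡⟨ tilings-linear n 1ℤ count 1ℤ one ⟩
  1ℤ ℤ.* tilings n count ℤ.+ 1ℤ ℤ.* tilings n one
    ≡⟨ cong₂ ℤ._+_ (ℤ.*-identityˡ (tilings n count)) (trans (ℤ.*-identityˡ (tilings n one)) (tilings-one n)) ⟩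
  tilings n count ℤ.+ + fib (suc n) ∎)
  where
  open ≡-Reasoning
  lem : ∀ m → 1ℤ ℤ.+ m ≡ 1ℤ ℤ.* m ℤ.+ 1ℤ ℤ.* 1ℤ
  lem = ℤSolver.solve-∀

count²-step : ∀ n → tilings (2 + n) count² ≡
  tilings (1 + n) count² ℤ.+ (tilings n count² ℤ.+ (+ 2 ℤ.* tilings n count ℤ.+ + fib (suc n)))
count²-step n = cong (λ z → tilings (1 + n) count² ℤ.+ z) (begin
  tilings n (count² ∘ suc)
    ≡⟨ tilings-cong n (λ m → lem (+ m)) ⟩
  tilings n (λ m → 1ℤ ℤ.* count² m ℤ.+ 1ℤ ℤ.* (+ 2 ℤ.* count m ℤ.+ 1ℤ ℤ.* one m))
    ≡⟨ tilings-linear n 1ℤ count² 1ℤ _ ⟩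
  1ℤ ℤ.* tilings n count² ℤ.+ 1ℤ ℤ.* tilings n (λ m → + 2 ℤ.* count m ℤ.+ 1ℤ ℤ.* one m)
    ≡⟨ cong₂ ℤ._+_ (ℤ.*-identityˡ (tilings n count²)) (trans (ℤ.*-identityˡ _) (tilings-linear n (+ 2) count 1ℤ one)) ⟩
  tilings n count² ℤ.+ (+ 2 ℤ.* tilings n count ℤ.+ 1ℤ ℤ.* tilings n one)
    ≡⟨ cong (λ z → tilings n count² ℤ.+ (+ 2 ℤ.* tilings n count ℤ.+ z)) (trans (ℤ.*-identityˡ (tilings n one)) (tilings-one n)) ⟩
  tilings n count² ℤ.+ (+ 2 ℤ.* tilings n count ℤ.+ + fib (suc n)) ∎)
  where
  open ≡-Reasoning
  lem : ∀ m → (1ℤ ℤ.+ m) ℤ.* (1ℤ ℤ.+ m) ≡ 1ℤ ℤ.* (m ℤ.* m) ℤ.+ 1ℤ ℤ.* (+ 2 ℤ.* m ℤ.+ 1ℤ ℤ.* 1ℤ)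
  lem = ℤSolver.solve-∀

-- The inhomogeneous term of `count-step` itself solves the Fibonacci recurrence, so the solution is
-- a combination of F_{n+1} and F_n with coefficients linear in n. The 5 that clears denominators is
-- the discriminant of x² - x - 1.
count-closed : ∀ n → + 5 ℤ.* tilings n count ≡ + 2 ℤ.* + n ℤ.* + fib (suc n) ℤ.- (+ n ℤ.+ 1ℤ) ℤ.* + fib n
count-closed zero          = refl
count-closed (suc zero)    = refl
count-closed (suc (suc n)) = begin
  + 5 ℤ.* tilings (2 + n) count
    ≡⟨ cong (+ 5 ℤ.*_) (count-step n) ⟩
  + 5 ℤ.* (tilings (1 + n) count ℤ.+ (tilings n count ℤ.+ f))
    ≡⟨ expand (tilings (1 + n) count) (tilings n count) f ⟩
  + 5 ℤ.* tilings (1 + n) count ℤ.+ (+ 5 ℤ.* tilings n count ℤ.+ + 5 ℤ.* f)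
    ≡⟨ cong₂ (λ x y → x ℤ.+ (y ℤ.+ + 5 ℤ.* f)) (count-closed (suc n)) (count-closed n) ⟩
  (+ 2 ℤ.* (1ℤ ℤ.+ + n) ℤ.* (f ℤ.+ h) ℤ.- ((1ℤ ℤ.+ + n) ℤ.+ 1ℤ) ℤ.* f) ℤ.+
  ((+ 2 ℤ.* + n ℤ.* f ℤ.- (+ n ℤ.+ 1ℤ) ℤ.* h) ℤ.+ + 5 ℤ.* f)
    ≡⟨ lem (+ n) f h ⟩
  + 2 ℤ.* (+ 2 ℤ.+ + n) ℤ.* ((f ℤ.+ h) ℤ.+ f) ℤ.- ((+ 2 ℤ.+ + n) ℤ.+ 1ℤ) ℤ.* (f ℤ.+ h) ∎
  where
  open ≡-Reasoning
  f h : ℤ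
  f = + fib (suc n)
  h = + fib n
  expand : ∀ x y z → + 5 ℤ.* (x ℤ.+ (y ℤ.+ z)) ≡ + 5 ℤ.* x ℤ.+ (+ 5 ℤ.* y ℤ.+ + 5 ℤ.* z)
  expand = ℤSolver.solve-∀
  lem : ∀ n f h →
    (+ 2 ℤ.* (1ℤ ℤ.+ n) ℤ.* (f ℤ.+ h) ℤ.- ((1ℤ ℤ.+ n) ℤ.+ 1ℤ) ℤ.* f) ℤ.+
    ((+ 2 ℤ.* n ℤ.* f ℤ.- (n ℤ.+ 1ℤ) ℤ.* h) ℤ.+ + 5 ℤ.* f) ≡
    + 2 ℤ.* (+ 2 ℤ.+ n) ℤ.* ((f ℤ.+ h) ℤ.+ f) ℤ.- ((+ 2 ℤ.+ n) ℤ.+ 1ℤ) ℤ.* (f ℤ.+ h)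
  lem = ℤSolver.solve-∀

-- 25 times the second moment, for f = F_{n+1} and h = F_n. In `count²-step` the inhomogeneous term
-- already has linear coefficients, hence quadratic ones here.
closed² : ℤ → ℤ → ℤ → ℤ
closed² n f h = (+ 5 ℤ.* n ℤ.* n ℤ.+ + 3 ℤ.* n) ℤ.* f ℤ.- (+ 5 ℤ.* n ℤ.* n ℤ.+ + 4 ℤ.* n ℤ.- 1ℤ) ℤ.* h

count²-closed : ∀ n → + 25 ℤ.* tilings n count² ≡ closed² (+ n) (+ fib (suc n)) (+ fib n)
count²-closed zero          = refl
count²-closed (suc zero)    = refl
count²-closed (suc (suc n)) = begin
  + 25 ℤ.* tilings (2 + n) count²
    ≡⟨ cong (+ 25 ℤ.*_) (count²-step n) ⟩
  + 25 ℤ.* (tilings (1 + n) count² ℤ.+ (tilings n count² ℤ.+ (+ 2 ℤ.* tilings n count ℤ.+ f)))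
    ≡⟨ expand (tilings (1 + n) count²) (tilings n count²) (tilings n count) f ⟩
  + 25 ℤ.* tilings (1 + n) count² ℤ.+ (+ 25 ℤ.* tilings n count² ℤ.+ (+ 10 ℤ.* (+ 5 ℤ.* tilings n count) ℤ.+ + 25 ℤ.* f))
    ≡⟨ cong₂ (λ x y → x ℤ.+ (y ℤ.+ (+ 10 ℤ.* (+ 5 ℤ.* tilings n count) ℤ.+ + 25 ℤ.* f))) (count²-closed (suc n)) (count²-closed n) ⟩
  closed² (1ℤ ℤ.+ + n) (f ℤ.+ h) f ℤ.+ (closed² (+ n) f h ℤ.+ (+ 10 ℤ.* (+ 5 ℤ.* tilings n count) ℤ.+ + 25 ℤ.* f))
    ≡⟨ cong (λ x → closed² (1ℤ ℤ.+ + n) (f ℤ.+ h) f ℤ.+ (closed² (+ n) f h ℤ.+ (+ 10 ℤ.* x ℤ.+ + 25 ℤ.* f))) (count-closed n) ⟩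
  closed² (1ℤ ℤ.+ + n) (f ℤ.+ h) f ℤ.+ (closed² (+ n) f h ℤ.+ (+ 10 ℤ.* (+ 2 ℤ.* + n ℤ.* f ℤ.- (+ n ℤ.+ 1ℤ) ℤ.* h) ℤ.+ + 25 ℤ.* f))
    ≡⟨ lem (+ n) f h ⟩
  closed² (+ 2 ℤ.+ + n) ((f ℤ.+ h) ℤ.+ f) (f ℤ.+ h) ∎
  where
  open ≡-Reasoning
  f h : ℤ
  f = + fib (suc n)
  h = + fib n
  expand : ∀ x y z w → + 25 ℤ.* (x ℤ.+ (y ℤ.+ (+ 2 ℤ.* z ℤ.+ w))) ≡
    + 25 ℤ.* x ℤ.+ (+ 25 ℤ.* y ℤ.+ (+ 10 ℤ.* (+ 5 ℤ.* z) ℤ.+ + 25 ℤ.* w))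
  expand = ℤSolver.solve-∀
  lem : ∀ n f h →
    ((+ 5 ℤ.* (1ℤ ℤ.+ n) ℤ.* (1ℤ ℤ.+ n) ℤ.+ + 3 ℤ.* (1ℤ ℤ.+ n)) ℤ.* (f ℤ.+ h) ℤ.- (+ 5 ℤ.* (1ℤ ℤ.+ n) ℤ.* (1ℤ ℤ.+ n) ℤ.+ + 4 ℤ.* (1ℤ ℤ.+ n) ℤ.- 1ℤ) ℤ.* f) ℤ.+
    (((+ 5 ℤ.* n ℤ.* n ℤ.+ + 3 ℤ.* n) ℤ.* f ℤ.- (+ 5 ℤ.* n ℤ.* n ℤ.+ + 4 ℤ.* n ℤ.- 1ℤ) ℤ.* h) ℤ.+
     (+ 10 ℤ.* (+ 2 ℤ.* n ℤ.* f ℤ.- (n ℤ.+ 1ℤ) ℤ.* h) ℤ.+ + 25 ℤ.* f)) ≡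
    (+ 5 ℤ.* (+ 2 ℤ.+ n) ℤ.* (+ 2 ℤ.+ n) ℤ.+ + 3 ℤ.* (+ 2 ℤ.+ n)) ℤ.* ((f ℤ.+ h) ℤ.+ f) ℤ.- (+ 5 ℤ.* (+ 2 ℤ.+ n) ℤ.* (+ 2 ℤ.+ n) ℤ.+ + 4 ℤ.* (+ 2 ℤ.+ n) ℤ.- 1ℤ) ℤ.* (f ℤ.+ h)
  lem = ℤSolver.solve-∀

0≤+ : ∀ n → 0ℤ ℤ.≤ + n
0≤+ n = +≤+ z≤n

0≤i+j : ∀ {i j} → 0ℤ ℤ.≤ i → 0ℤ ℤ.≤ j → 0ℤ ℤ.≤ i ℤ.+ j
0≤i+j = ℤ.+-mono-≤

0≤i*j : ∀ {i j} → 0ℤ ℤ.≤ i → 0ℤ ℤ.≤ j → 0ℤ ℤ.≤ i ℤ.* j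
0≤i*j {j = j} 0≤i 0≤j = ℤ.*-monoʳ-≤-nonNeg j {{ℤ.nonNegative 0≤j}} 0≤i

i≤0⇒i*j≤0 : ∀ {i j} → i ℤ.≤ 0ℤ → 0ℤ ℤ.≤ j → i ℤ.* j ℤ.≤ 0ℤ
i≤0⇒i*j≤0 {j = j} i≤0 0≤j = ℤ.*-monoʳ-≤-nonNeg j {{ℤ.nonNegative 0≤j}} i≤0

≤-by-difference : ∀ {i j d} → j ℤ.- i ≡ d → 0ℤ ℤ.≤ d → i ℤ.≤ j
≤-by-difference refl 0≤d = ℤ.0≤i-j⇒j≤i 0≤d

cassini : ∀ n → let f = + fib (suc n); h = + fib n; c = f ℤ.* f ℤ.- f ℤ.* h ℤ.- h ℤ.* h in c ≡ 1ℤ ⊎ c ≡ -1ℤ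
cassini zero    = inj₁ refl
cassini (suc n) = flip (cassini n)
  where
  f h : ℤ
  f = + fib (suc n)
  h = + fib n
  alternate : ∀ f h → (f ℤ.+ h) ℤ.* (f ℤ.+ h) ℤ.- (f ℤ.+ h) ℤ.* f ℤ.- f ℤ.* f ≡ ℤ.- (f ℤ.* f ℤ.- f ℤ.* h ℤ.- h ℤ.* h)
  alternate = ℤSolver.solve-∀
  flip : let c = f ℤ.* f ℤ.- f ℤ.* h ℤ.- h ℤ.* h
             c′ = (f ℤ.+ h) ℤ.* (f ℤ.+ h) ℤ.- (f ℤ.+ h) ℤ.* f ℤ.- f ℤ.* f
         in c ≡ 1ℤ ⊎ c ≡ -1ℤ → c′ ≡ 1ℤ ⊎ c′ ≡ -1ℤ
  flip (inj₁ c≡1)  = inj₂ (trans (alternate f h) (cong ℤ.-_ c≡1))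
  flip (inj₂ c≡-1) = inj₁ (trans (alternate f h) (cong ℤ.-_ c≡-1))

5+k≤fib[5+k] : ∀ k → 5 + k ≤ fib (5 + k)
5+k≤fib[5+k] zero    = ≤-refl
5+k≤fib[5+k] (suc k) = ≤-trans (≤-reflexive (+-comm 1 (5 + k)))
  (+-mono-≤ (5+k≤fib[5+k] k) (fib-mono {1} {4 + k} (s≤s z≤n)))

-- With f = F_{n+1} and h = F_n, the closed forms give 25 (f S₂ - S₁²) = n² (f² - f h - h²) + n (3f²
-- - 2h²) + f h - h². Cassini's identity reduces the quadratic part to at most n², so the variance
-- grows linearly. The constant 1/8 is chosen just above 3/25: the difference leaves n f², which
-- absorbs the term in f h once n ≥ 8, and n ≤ F_n lets n h² absorb the n².
variance-bound : ∀ {n} → 8 ≤ n →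
  + 8 ℤ.* (+ fib (suc n) ℤ.* tilings n count² ℤ.- tilings n count ℤ.* tilings n count)
    ℤ.≤ + n ℤ.* (+ fib (suc n) ℤ.* + fib (suc n))
variance-bound {n} 8≤n = ℤ.*-cancelˡ-≤-pos _ _ (+ 25) (≤-by-difference difference nonneg)
  where
  N f h c S₁ S₂ d : ℤ
  N = + n
  f = + fib (suc n)
  h = + fib n
  S₁ = tilings n count
  S₂ = tilings n count²
  c = f ℤ.* f ℤ.- f ℤ.* h ℤ.- h ℤ.* h
  d = f ℤ.* ((N ℤ.- + 8) ℤ.* f ℤ.+ + 8 ℤ.* (f ℤ.- h)) ℤ.+
      + 8 ℤ.* N ℤ.* (+ 2 ℤ.* (h ℤ.* h) ℤ.- N) ℤ.+ + 8 ℤ.* (h ℤ.* h) ℤ.+ + 8 ℤ.* (N ℤ.* N) ℤ.* (1ℤ ℤ.- c)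
  lem₁ : ∀ N f S₁ S₂ → + 25 ℤ.* (N ℤ.* (f ℤ.* f)) ℤ.- + 25 ℤ.* (+ 8 ℤ.* (f ℤ.* S₂ ℤ.- S₁ ℤ.* S₁)) ≡
    + 25 ℤ.* (N ℤ.* (f ℤ.* f)) ℤ.- + 8 ℤ.* (f ℤ.* (+ 25 ℤ.* S₂) ℤ.- (+ 5 ℤ.* S₁) ℤ.* (+ 5 ℤ.* S₁))
  lem₁ = ℤSolver.solve-∀
  lem₂ : ∀ N f h →
    + 25 ℤ.* (N ℤ.* (f ℤ.* f)) ℤ.-
      + 8 ℤ.* (f ℤ.* ((+ 5 ℤ.* N ℤ.* N ℤ.+ + 3 ℤ.* N) ℤ.* f ℤ.- (+ 5 ℤ.* N ℤ.* N ℤ.+ + 4 ℤ.* N ℤ.- 1ℤ) ℤ.* h) ℤ.-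
               (+ 2 ℤ.* N ℤ.* f ℤ.- (N ℤ.+ 1ℤ) ℤ.* h) ℤ.* (+ 2 ℤ.* N ℤ.* f ℤ.- (N ℤ.+ 1ℤ) ℤ.* h)) ≡
    f ℤ.* ((N ℤ.- + 8) ℤ.* f ℤ.+ + 8 ℤ.* (f ℤ.- h)) ℤ.+
      + 8 ℤ.* N ℤ.* (+ 2 ℤ.* (h ℤ.* h) ℤ.- N) ℤ.+ + 8 ℤ.* (h ℤ.* h) ℤ.+
      + 8 ℤ.* (N ℤ.* N) ℤ.* (1ℤ ℤ.- (f ℤ.* f ℤ.- f ℤ.* h ℤ.- h ℤ.* h))
  lem₂ = ℤSolver.solve-∀
  difference : + 25 ℤ.* (N ℤ.* (f ℤ.* f)) ℤ.- + 25 ℤ.* (+ 8 ℤ.* (f ℤ.* S₂ ℤ.- S₁ ℤ.* S₁)) ≡ d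
  difference = trans (lem₁ N f S₁ S₂) (trans
    (cong₂ (λ x y → + 25 ℤ.* (N ℤ.* (f ℤ.* f)) ℤ.- + 8 ℤ.* (f ℤ.* x ℤ.- y ℤ.* y)) (count²-closed n) (count-closed n))
    (lem₂ N f h))
  0≤N-8 : 0ℤ ℤ.≤ N ℤ.- + 8
  0≤N-8 = ℤ.i≤j⇒0≤j-i (+≤+ 8≤n)
  0≤f-h : 0ℤ ℤ.≤ f ℤ.- h
  0≤f-h = ℤ.i≤j⇒0≤j-i (+≤+ (fib-suc-≥ n))
  n≤fib : n ≤ fib n
  n≤fib = subst (λ k → k ≤ fib k) (m+[n∸m]≡n (≤-trans (m≤m+n 5 3) 8≤n)) (5+k≤fib[5+k] (n ∸ 5))
  n≤2hh : n ≤ 2 * (fib n * fib n)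
  n≤2hh = ≤-trans n≤fib (≤-trans (m≤m*n (fib n) (fib n) {{>-nonZero (≤-trans (≤-trans (s≤s z≤n) 8≤n) n≤fib)}})
            (m≤n*m (fib n * fib n) 2))
  0≤hh : 0ℤ ℤ.≤ h ℤ.* h
  0≤hh = 0≤i*j (0≤+ (fib n)) (0≤+ (fib n))
  0≤2hh-N : 0ℤ ℤ.≤ + 2 ℤ.* (h ℤ.* h) ℤ.- N
  0≤2hh-N = ℤ.i≤j⇒0≤j-i (subst (N ℤ.≤_)
    (trans (ℤ.pos-* 2 (fib n * fib n)) (cong (λ z → + 2 ℤ.* z) (ℤ.pos-* (fib n) (fib n)))) (+≤+ n≤2hh))
  0≤1-c : 0ℤ ℤ.≤ 1ℤ ℤ.- c
  0≤1-c with cassini n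
  ... | inj₁ c≡1  = subst (λ z → 0ℤ ℤ.≤ 1ℤ ℤ.- z) (sym c≡1) ℤ.≤-refl
  ... | inj₂ c≡-1 = subst (λ z → 0ℤ ℤ.≤ 1ℤ ℤ.- z) (sym c≡-1) (+≤+ z≤n)
  nonneg : 0ℤ ℤ.≤ d
  nonneg = 0≤i+j (0≤i+j (0≤i+j
    (0≤i*j (0≤+ (fib (suc n))) (0≤i+j (0≤i*j 0≤N-8 (0≤+ (fib (suc n)))) (0≤i*j (0≤+ 8) 0≤f-h)))
    (0≤i*j (0≤i*j (0≤+ 8) (0≤+ n)) 0≤2hh-N))
    (0≤i*j (0≤+ 8) 0≤hh))
    (0≤i*j (0≤i*j (0≤+ 8) (0≤i*j (0≤+ n) (0≤+ n))) 0≤1-c)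

-- Tilings in a window around the mean

-- The position is an integer because a window around the mean may begin below 0, where no tiling is
-- hit.
hit : ℤ → ℕ → ℤ
hit (+ k)    m = + 𝟙 (m ≡ᵇ k)
hit -[1+ _ ] m = 0ℤ

0Ck≡0 : ∀ k → 0 C suc k ≡ 0
0Ck≡0 k = k>n⇒nCk≡0 (s≤s (z≤n {k}))

tilings-hit : ∀ n k → tilings n (hit (+ k)) ≡ + ((n ∸ k) C k)
tilings-hit zero       zero    = refl
tilings-hit zero       (suc k) = cong +_ (sym (0Ck≡0 k))
tilings-hit (suc zero) zero    = refl
tilings-hit (suc zero) (suc k) = cong +_ (sym (trans (cong (_C suc k) (0∸n≡0 k)) (0Ck≡0 k)))
tilings-hit (suc (suc n)) zero = trans
  (cong₂ ℤ._+_ (trans (tilings-hit (suc n) 0) (cong +_ (nC0≡1 (suc n)))) (tilings-zero n))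
  (cong +_ (sym (nC0≡1 (2 + n))))
tilings-hit (suc (suc n)) (suc k) = trans
  (cong₂ ℤ._+_ (tilings-hit (suc n) (suc k)) (tilings-hit n k)) (cong +_ pascal)
  where
  pascal : (n ∸ k) C suc k + (n ∸ k) C k ≡ (suc n ∸ k) C suc k
  pascal with k ≤? n
  ... | yes k≤n = trans (+-comm ((n ∸ k) C suc k) _) (trans (nCk+nC[k+1]≡[n+1]C[k+1] (n ∸ k) k)
                    (cong (_C suc k) (sym (+-∸-assoc 1 k≤n))))
  -- For k > n all the truncated differences are 0, and k ≥ 1 makes all three binomial coefficients
  -- vanish.
  ... | no  k≰n = beyond (≰⇒> k≰n)
    where
    beyond : ∀ {k} → n < k → (n ∸ k) C suc k + (n ∸ k) C k ≡ (suc n ∸ k) C suc k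
    beyond {suc j} n<k@(s≤s n≤j)
      rewrite m≤n⇒m∸n≡0 (<⇒≤ n<k) | m≤n⇒m∸n≡0 n≤j | 0Ck≡0 j | 0Ck≡0 (suc j) = refl

module Window (c : ℤ) (w : ℕ) where

  -- bump k = w² - (k - w)², so that window (2w + 1) is the parabola w² - (m - c)² truncated at 0.
  bump : ℕ → ℤ
  bump k = + k ℤ.* (+ (2 * w) ℤ.- + k)

  window : ℕ → ℕ → ℤ
  window zero    m = 0ℤ
  -- The factor 1ℤ gives the sum the shape required by `tilings-linear`.
  window (suc t) m = bump t ℤ.* hit (c ℤ.- + w ℤ.+ + t) m ℤ.+ 1ℤ ℤ.* window t m

  total : ℕ → ℤ
  total zero    = 0ℤ
  total (suc t) = bump t ℤ.+ total t

  0≤bump : ∀ {k} → k ≤ 2 * w → 0ℤ ℤ.≤ bump k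
  0≤bump {k} k≤2w = 0≤i*j (0≤+ k) (ℤ.i≤j⇒0≤j-i (+≤+ k≤2w))

  0≤hit : ∀ z m → 0ℤ ℤ.≤ hit z m
  0≤hit (+ k)    m = 0≤+ _
  0≤hit -[1+ _ ] m = ℤ.≤-refl

  0≤window : ∀ {t} m → t ≤ suc (2 * w) → 0ℤ ℤ.≤ window t m
  0≤window {zero}  m _        = ℤ.≤-refl
  0≤window {suc t} m (s≤s t≤) = 0≤i+j (0≤i*j (0≤bump t≤) (0≤hit _ m)) (0≤i*j (0≤+ 1) (0≤window {t} m (m≤n⇒m≤1+n t≤)))

  hit-self : ∀ m → hit (+ m) m ≡ 1ℤ
  hit-self zero    = refl
  hit-self (suc m) = hit-self m

  bump≤window : ∀ {t k} m → t ≤ suc (2 * w) → k < t → c ℤ.- + w ℤ.+ + k ≡ + m → bump k ℤ.≤ window t m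
  bump≤window {suc t} {k} m (s≤s t≤) (s≤s k≤t) at with m≤n⇒m<n∨m≡n k≤t
  ... | inj₂ refl = ≤-by-difference
    (trans (cong (λ z → bump k ℤ.* hit z m ℤ.+ 1ℤ ℤ.* window k m ℤ.- bump k) at)
      (trans (cong (λ z → bump k ℤ.* z ℤ.+ 1ℤ ℤ.* window k m ℤ.- bump k) (hit-self m)) (lem (bump k) (window k m))))
    (0≤window m (m≤n⇒m≤1+n t≤))
    where
    lem : ∀ a b → a ℤ.* 1ℤ ℤ.+ 1ℤ ℤ.* b ℤ.- a ≡ b
    lem = ℤSolver.solve-∀
  ... | inj₁ k<t = ℤ.≤-trans (bump≤window m (m≤n⇒m≤1+n t≤) k<t at)
    (≤-by-difference (lem (bump t ℤ.* hit (c ℤ.- + w ℤ.+ + t) m) (window t m)) (0≤i*j (0≤bump t≤) (0≤hit _ m)))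
    where
    lem : ∀ a b → a ℤ.+ 1ℤ ℤ.* b ℤ.- b ≡ a
    lem = ℤSolver.solve-∀

  parabola : ℕ → ℤ
  parabola m = + w ℤ.* + w ℤ.- (+ m ℤ.- c) ℤ.* (+ m ℤ.- c)

  -- In terms of the position d = m - c + w inside the window, the parabola is d (2w - d). For 0 ≤ d
  -- ≤ 2w this is the bump at d, and outside that range it is at most 0.
  parabola≤window : ∀ m → parabola m ℤ.≤ window (suc (2 * w)) m
  parabola≤window m = subst (ℤ._≤ window (suc (2 * w)) m) (sym (factor (+ m) c (+ w))) (bound (+ m ℤ.- c ℤ.+ + w) refl)
    where
    factor : ∀ m c w → w ℤ.* w ℤ.- (m ℤ.- c) ℤ.* (m ℤ.- c) ≡ (m ℤ.- c ℤ.+ w) ℤ.* (+ 2 ℤ.* w ℤ.- (m ℤ.- c ℤ.+ w))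
    factor = ℤSolver.solve-∀
    locate : ∀ m c w → c ℤ.- w ℤ.+ (m ℤ.- c ℤ.+ w) ≡ m
    locate = ℤSolver.solve-∀
    0≤W : 0ℤ ℤ.≤ window (suc (2 * w)) m
    0≤W = 0≤window m ≤-refl
    bound : ∀ d → + m ℤ.- c ℤ.+ + w ≡ d → d ℤ.* (+ 2 ℤ.* + w ℤ.- d) ℤ.≤ window (suc (2 * w)) m
    bound (+ k) d≡ with k ≤? 2 * w
    ... | yes k≤2w = subst (λ z → + k ℤ.* (z ℤ.- + k) ℤ.≤ window (suc (2 * w)) m) (ℤ.pos-* 2 w)
      (bump≤window m ≤-refl (s≤s k≤2w) (trans (cong (λ z → c ℤ.- + w ℤ.+ z) (sym d≡)) (locate (+ m) c (+ w))))
    ... | no k≰2w = ℤ.≤-trans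
      (subst (ℤ._≤ 0ℤ) (ℤ.*-comm (+ 2 ℤ.* + w ℤ.- + k) (+ k))
        (i≤0⇒i*j≤0 (ℤ.i≤j⇒i-j≤0 (subst (ℤ._≤ + k) (ℤ.pos-* 2 w) (+≤+ (<⇒≤ (≰⇒> k≰2w))))) (0≤+ k)))
      0≤W
    bound -[1+ k ] d≡ = ℤ.≤-trans
      (i≤0⇒i*j≤0 { -[1+ k ]} -≤+ (0≤i+j (0≤i*j (0≤+ 2) (0≤+ w)) (0≤+ (suc k)))) 0≤W

  total-closed : ∀ t → + 6 ℤ.* total t ≡
    + 6 ℤ.* + w ℤ.* + t ℤ.* (+ t ℤ.- 1ℤ) ℤ.- + t ℤ.* (+ t ℤ.- 1ℤ) ℤ.* (+ 2 ℤ.* + t ℤ.- 1ℤ)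
  total-closed zero    = lem (+ w)
    where
    lem : ∀ w → + 6 ℤ.* 0ℤ ≡ + 6 ℤ.* w ℤ.* 0ℤ ℤ.* (0ℤ ℤ.- 1ℤ) ℤ.- 0ℤ ℤ.* (0ℤ ℤ.- 1ℤ) ℤ.* (+ 2 ℤ.* 0ℤ ℤ.- 1ℤ)
    lem = ℤSolver.solve-∀
  total-closed (suc t) = begin
    + 6 ℤ.* (bump t ℤ.+ total t)
      ≡⟨ ℤ.*-distribˡ-+ (+ 6) (bump t) (total t) ⟩
    + 6 ℤ.* bump t ℤ.+ + 6 ℤ.* total t
      ≡⟨ cong₂ (λ x y → + 6 ℤ.* (+ t ℤ.* (x ℤ.- + t)) ℤ.+ y) (ℤ.pos-* 2 w) (total-closed t) ⟩
    + 6 ℤ.* (+ t ℤ.* (+ 2 ℤ.* + w ℤ.- + t)) ℤ.+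
      (+ 6 ℤ.* + w ℤ.* + t ℤ.* (+ t ℤ.- 1ℤ) ℤ.- + t ℤ.* (+ t ℤ.- 1ℤ) ℤ.* (+ 2 ℤ.* + t ℤ.- 1ℤ))
      ≡⟨ lem (+ w) (+ t) ⟩
    + 6 ℤ.* + w ℤ.* (1ℤ ℤ.+ + t) ℤ.* ((1ℤ ℤ.+ + t) ℤ.- 1ℤ) ℤ.-
      (1ℤ ℤ.+ + t) ℤ.* ((1ℤ ℤ.+ + t) ℤ.- 1ℤ) ℤ.* (+ 2 ℤ.* (1ℤ ℤ.+ + t) ℤ.- 1ℤ) ∎
    where
    open ≡-Reasoning
    lem : ∀ w t → + 6 ℤ.* (t ℤ.* (+ 2 ℤ.* w ℤ.- t)) ℤ.+
      (+ 6 ℤ.* w ℤ.* t ℤ.* (t ℤ.- 1ℤ) ℤ.- t ℤ.* (t ℤ.- 1ℤ) ℤ.* (+ 2 ℤ.* t ℤ.- 1ℤ)) ≡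
      + 6 ℤ.* w ℤ.* (1ℤ ℤ.+ t) ℤ.* ((1ℤ ℤ.+ t) ℤ.- 1ℤ) ℤ.-
      (1ℤ ℤ.+ t) ℤ.* ((1ℤ ℤ.+ t) ℤ.- 1ℤ) ℤ.* (+ 2 ℤ.* (1ℤ ℤ.+ t) ℤ.- 1ℤ)
    lem = ℤSolver.solve-∀

  -- The exact value is 8w³ - 2w; the integral of the parabola over its support is 4w³/3.
  total-bound : + 6 ℤ.* total (suc (2 * w)) ℤ.≤ + 8 ℤ.* (+ w ℤ.* + w ℤ.* + w)
  total-bound = ≤-by-difference
    (trans (cong (λ z → + 8 ℤ.* (+ w ℤ.* + w ℤ.* + w) ℤ.- z) (total-closed (suc (2 * w))))
      (trans (cong (λ z → + 8 ℤ.* (+ w ℤ.* + w ℤ.* + w) ℤ.-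
           (+ 6 ℤ.* + w ℤ.* (1ℤ ℤ.+ z) ℤ.* ((1ℤ ℤ.+ z) ℤ.- 1ℤ) ℤ.-
            (1ℤ ℤ.+ z) ℤ.* ((1ℤ ℤ.+ z) ℤ.- 1ℤ) ℤ.* (+ 2 ℤ.* (1ℤ ℤ.+ z) ℤ.- 1ℤ))) (ℤ.pos-* 2 w))
        (lem (+ w))))
    (0≤i*j (0≤+ 2) (0≤+ w))
    where
    lem : ∀ w → + 8 ℤ.* (w ℤ.* w ℤ.* w) ℤ.-
      (+ 6 ℤ.* w ℤ.* (1ℤ ℤ.+ + 2 ℤ.* w) ℤ.* ((1ℤ ℤ.+ + 2 ℤ.* w) ℤ.- 1ℤ) ℤ.-
       (1ℤ ℤ.+ + 2 ℤ.* w) ℤ.* ((1ℤ ℤ.+ + 2 ℤ.* w) ℤ.- 1ℤ) ℤ.* (+ 2 ℤ.* (1ℤ ℤ.+ + 2 ℤ.* w) ℤ.- 1ℤ)) ≡ + 2 ℤ.* w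
    lem = ℤSolver.solve-∀

⌊√_⌋ : ∀ n → ∃[ w ] (w * w ≤ n × n ≤ w * w + 2 * w)
⌊√ zero ⌋  = 0 , z≤n , z≤n
⌊√ suc n ⌋ with ⌊√ n ⌋
... | w , ww≤n , n≤ with suc w * suc w ≤? suc n
...   | yes ww≤ = suc w , ww≤ , ≤-trans (s≤s n≤) (≤-trans (≤-reflexive (lem w)) (m≤m+n (suc w * suc w) (2 * suc w)))
  where
  lem : ∀ w → suc (w * w + 2 * w) ≡ suc w * suc w
  lem = solve-∀
...   | no ww≰ = w , m≤n⇒m≤1+n ww≤n , ≤-pred (≤-trans (≰⇒> ww≰) (≤-reflexive (lem w)))
  where
  lem : ∀ w → suc w * suc w ≡ suc (w * w + 2 * w)
  lem = solve-∀

module _ {n p B : ℕ} (tiling-bound : ∀ m → m ≤ n → p * ((n ∸ m) C m) ≤ B) where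

  private
    P F S₁ S₂ : ℤ
    P = + p
    F = + fib (suc n)
    S₁ = tilings n count
    S₂ = tilings n count²

  p*hit≤B : ∀ z → P ℤ.* tilings n (hit z) ℤ.≤ + B
  p*hit≤B -[1+ _ ] = ℤ.≤-trans (ℤ.≤-reflexive (trans (cong (λ z → P ℤ.* z) (tilings-zero n)) (ℤ.*-zeroʳ P))) (0≤+ B)
  p*hit≤B (+ k) = ℤ.≤-trans
    (ℤ.≤-reflexive (trans (cong (λ z → P ℤ.* z) (tilings-hit n k)) (sym (ℤ.pos-* p ((n ∸ k) C k)))))
    (+≤+ bound)
    where
    bound : p * ((n ∸ k) C k) ≤ B
    bound with k ≤? n
    ... | yes k≤n = tiling-bound k k≤n
    ... | no  k≰n = beyond (≰⇒> k≰n)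
      where
      beyond : ∀ {k} → n < k → p * ((n ∸ k) C k) ≤ B
      beyond {suc j} n<k rewrite m≤n⇒m∸n≡0 (<⇒≤ n<k) | 0Ck≡0 j | *-zeroʳ p = z≤n

  module _ (c : ℤ) (w : ℕ) where
    open Window c w

    p*window≤B*total : ∀ t → t ≤ suc (2 * w) → P ℤ.* tilings n (window t) ℤ.≤ + B ℤ.* total t
    p*window≤B*total zero _ = ℤ.≤-reflexive (trans (cong (λ z → P ℤ.* z) (tilings-zero n)) (trans (ℤ.*-zeroʳ P) (sym (ℤ.*-zeroʳ (+ B)))))
    p*window≤B*total (suc t) (s≤s t≤2w) = begin
      P ℤ.* tilings n (window (suc t))
        ≡⟨ cong (λ z → P ℤ.* z) (tilings-linear n (bump t) (hit (c ℤ.- + w ℤ.+ + t)) 1ℤ (window t)) ⟩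
      P ℤ.* (bump t ℤ.* H ℤ.+ 1ℤ ℤ.* W)
        ≡⟨ lem₁ P (bump t) H W ⟩
      bump t ℤ.* (P ℤ.* H) ℤ.+ P ℤ.* W
        ≤⟨ ℤ.+-mono-≤ (ℤ.*-monoˡ-≤-nonNeg (bump t) {{ℤ.nonNegative (0≤bump t≤2w)}} (p*hit≤B (c ℤ.- + w ℤ.+ + t)))
                      (p*window≤B*total t (m≤n⇒m≤1+n t≤2w)) ⟩
      bump t ℤ.* + B ℤ.+ + B ℤ.* total t
        ≡⟨ lem₂ (bump t) (+ B) (total t) ⟩
      + B ℤ.* (bump t ℤ.+ total t) ∎
      where
      open ℤ.≤-Reasoning
      H W : ℤ
      H = tilings n (hit (c ℤ.- + w ℤ.+ + t))
      W = tilings n (window t)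
      lem₁ : ∀ p b h w → p ℤ.* (b ℤ.* h ℤ.+ 1ℤ ℤ.* w) ≡ b ℤ.* (p ℤ.* h) ℤ.+ p ℤ.* w
      lem₁ = ℤSolver.solve-∀
      lem₂ : ∀ b B t → b ℤ.* B ℤ.+ B ℤ.* t ≡ B ℤ.* (b ℤ.+ t)
      lem₂ = ℤSolver.solve-∀

    3p*parabola≤4Bw³ : + 3 ℤ.* (P ℤ.* tilings n parabola) ℤ.≤ + 4 ℤ.* (+ B ℤ.* (+ w ℤ.* + w ℤ.* + w))
    3p*parabola≤4Bw³ = ℤ.*-cancelˡ-≤-pos _ _ (+ 2) (begin
      + 2 ℤ.* (+ 3 ℤ.* (P ℤ.* tilings n parabola))
        ≡⟨ lem₁ (P ℤ.* tilings n parabola) ⟩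
      + 6 ℤ.* (P ℤ.* tilings n parabola)
        ≤⟨ ℤ.*-monoˡ-≤-nonNeg (+ 6) (ℤ.*-monoˡ-≤-nonNeg P (tilings-mono n parabola≤window)) ⟩
      + 6 ℤ.* (P ℤ.* tilings n (window (suc (2 * w))))
        ≤⟨ ℤ.*-monoˡ-≤-nonNeg (+ 6) (p*window≤B*total (suc (2 * w)) ≤-refl) ⟩
      + 6 ℤ.* (+ B ℤ.* total (suc (2 * w)))
        ≡⟨ lem₂ (+ B) (total (suc (2 * w))) ⟩
      + B ℤ.* (+ 6 ℤ.* total (suc (2 * w)))
        ≤⟨ ℤ.*-monoˡ-≤-nonNeg (+ B) total-bound ⟩
      + B ℤ.* (+ 8 ℤ.* (+ w ℤ.* + w ℤ.* + w))
        ≡⟨ lem₃ (+ B) (+ w ℤ.* + w ℤ.* + w) ⟩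
      + 2 ℤ.* (+ 4 ℤ.* (+ B ℤ.* (+ w ℤ.* + w ℤ.* + w))) ∎)
      where
      open ℤ.≤-Reasoning
      lem₁ : ∀ x → + 2 ℤ.* (+ 3 ℤ.* x) ≡ + 6 ℤ.* x
      lem₁ = ℤSolver.solve-∀
      lem₂ : ∀ b t → + 6 ℤ.* (b ℤ.* t) ≡ b ℤ.* (+ 6 ℤ.* t)
      lem₂ = ℤSolver.solve-∀
      lem₃ : ∀ b t → b ℤ.* (+ 8 ℤ.* t) ≡ + 2 ℤ.* (+ 4 ℤ.* (b ℤ.* t))
      lem₃ = ℤSolver.solve-∀

    tilings-parabola : tilings n parabola ≡ (+ w ℤ.* + w ℤ.- c ℤ.* c) ℤ.* F ℤ.+ (+ 2 ℤ.* c ℤ.* S₁ ℤ.- S₂)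
    tilings-parabola = begin
      tilings n parabola
        ≡⟨ tilings-cong n (λ m → expand (+ m) c (+ w)) ⟩
      tilings n (λ m → (+ w ℤ.* + w ℤ.- c ℤ.* c) ℤ.* one m ℤ.+ 1ℤ ℤ.* (+ 2 ℤ.* c ℤ.* count m ℤ.+ -1ℤ ℤ.* count² m))
        ≡⟨ tilings-linear n (+ w ℤ.* + w ℤ.- c ℤ.* c) one 1ℤ (λ m → + 2 ℤ.* c ℤ.* count m ℤ.+ -1ℤ ℤ.* count² m) ⟩
      (+ w ℤ.* + w ℤ.- c ℤ.* c) ℤ.* tilings n one ℤ.+ 1ℤ ℤ.* tilings n (λ m → + 2 ℤ.* c ℤ.* count m ℤ.+ -1ℤ ℤ.* count² m)
        ≡⟨ cong₂ (λ x y → (+ w ℤ.* + w ℤ.- c ℤ.* c) ℤ.* x ℤ.+ 1ℤ ℤ.* y) (tilings-one n) (tilings-linear n (+ 2 ℤ.* c) count -1ℤ count²) ⟩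
      (+ w ℤ.* + w ℤ.- c ℤ.* c) ℤ.* F ℤ.+ 1ℤ ℤ.* (+ 2 ℤ.* c ℤ.* S₁ ℤ.+ -1ℤ ℤ.* S₂)
        ≡⟨ cong (λ z → (+ w ℤ.* + w ℤ.- c ℤ.* c) ℤ.* F ℤ.+ z) (lem (+ 2 ℤ.* c ℤ.* S₁) S₂) ⟩
      (+ w ℤ.* + w ℤ.- c ℤ.* c) ℤ.* F ℤ.+ (+ 2 ℤ.* c ℤ.* S₁ ℤ.- S₂) ∎
      where
      open ≡-Reasoning
      expand : ∀ m c w → w ℤ.* w ℤ.- (m ℤ.- c) ℤ.* (m ℤ.- c) ≡
        (w ℤ.* w ℤ.- c ℤ.* c) ℤ.* 1ℤ ℤ.+ 1ℤ ℤ.* (+ 2 ℤ.* c ℤ.* m ℤ.+ -1ℤ ℤ.* (m ℤ.* m))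
      expand = ℤSolver.solve-∀
      lem : ∀ x y → 1ℤ ℤ.* (x ℤ.+ -1ℤ ℤ.* y) ≡ x ℤ.- y
      lem = ℤSolver.solve-∀

  private instance
    F≢0 : NonZero (fib (suc n))
    F≢0 = >-nonZero (fib-mono {1} {suc n} (s≤s z≤n))

  -- Hits occur only at integers, so the true mean S₁/F is rounded down; the squared rounding error
  -- is the - 8 in `parabola-lower`.
  mean : ℤ
  mean = S₁ ℤ./ℕ fib (suc n)

  -- F · Σ (w² - (m - c)²) = w²F² - (F S₂ - S₁²) - (S₁ - c F)², and S₁ - c F is the remainder of S₁ modulo F.
  parabola-lower : 8 ≤ n → ∀ w →
    F ℤ.* (+ 8 ℤ.* (+ w ℤ.* + w) ℤ.- + n ℤ.- + 8) ℤ.≤ + 8 ℤ.* tilings n (Window.parabola mean w)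
  parabola-lower 8≤n w = ℤ.*-cancelˡ-≤-pos _ _ F {{ℤ.positive (ℤ.+<+ (>-nonZero⁻¹ (fib (suc n))))}}
    (≤-by-difference
      (trans (cong (λ z → F ℤ.* (+ 8 ℤ.* z) ℤ.- F ℤ.* (F ℤ.* (+ 8 ℤ.* (+ w ℤ.* + w) ℤ.- + n ℤ.- + 8))) (tilings-parabola mean w))
        (identity F S₁ S₂ mean (+ w) (+ n)))
      (0≤i+j (ℤ.i≤j⇒0≤j-i (variance-bound 8≤n)) (0≤i*j (0≤+ 8) (ℤ.i≤j⇒0≤j-i remainder²≤))))
    where
    identity : ∀ F S₁ S₂ c w n →
      F ℤ.* (+ 8 ℤ.* ((w ℤ.* w ℤ.- c ℤ.* c) ℤ.* F ℤ.+ (+ 2 ℤ.* c ℤ.* S₁ ℤ.- S₂))) ℤ.-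
        F ℤ.* (F ℤ.* (+ 8 ℤ.* (w ℤ.* w) ℤ.- n ℤ.- + 8)) ≡
      (n ℤ.* (F ℤ.* F) ℤ.- + 8 ℤ.* (F ℤ.* S₂ ℤ.- S₁ ℤ.* S₁)) ℤ.+
        + 8 ℤ.* (F ℤ.* F ℤ.- (S₁ ℤ.- c ℤ.* F) ℤ.* (S₁ ℤ.- c ℤ.* F))
    identity = ℤSolver.solve-∀
    r : ℕ
    r = S₁ ℤ.%ℕ fib (suc n)
    remainder : S₁ ℤ.- mean ℤ.* F ≡ + r
    remainder = trans (cong (λ z → z ℤ.- mean ℤ.* F) (ℤ.a≡a%ℕn+[a/ℕn]*n S₁ (fib (suc n)))) (lem (+ r) (mean ℤ.* F))
      where
      lem : ∀ x y → x ℤ.+ y ℤ.- y ≡ x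
      lem = ℤSolver.solve-∀
    r≤F : r ≤ fib (suc n)
    r≤F = <⇒≤ (ℤ.n%ℕd<d S₁ (fib (suc n)))
    remainder²≤ : (S₁ ℤ.- mean ℤ.* F) ℤ.* (S₁ ℤ.- mean ℤ.* F) ℤ.≤ F ℤ.* F
    remainder²≤ = subst (λ z → z ℤ.* z ℤ.≤ F ℤ.* F) (sym remainder)
      (subst₂ ℤ._≤_ (ℤ.pos-* r r) (ℤ.pos-* (fib (suc n)) (fib (suc n))) (+≤+ (*-mono-≤ r≤F r≤F)))

  -- Combining the two estimates of the parabola gives p F (8w² - n - 8) ≤ (32/3) B w³. From n ≤ w²
  -- + 2w one gets 8w² - n - 8 ≥ 7w² - 2w - 8, which is at least (56/9) w² for w ≥ 5 but not for w =
  -- 4; and (32/3)(9/56) = 12/7.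
  7pF≤12wB : ∀ {w} → 8 ≤ n → 5 ≤ w → n ≤ w * w + 2 * w → 7 * (p * fib (suc n)) ≤ 12 * (w * B)
  7pF≤12wB {w} 8≤n 5≤w n≤ = ℤ.drop‿+≤+ (subst₂ ℤ._≤_ (sym cast₁) (sym cast₂)
    (ℤ.*-cancelˡ-≤-pos _ _ (+ 24 ℤ.* (+ w ℤ.* + w)) {{positive}} (begin
      + 24 ℤ.* (+ w ℤ.* + w) ℤ.* (+ 7 ℤ.* (P ℤ.* F))
        ≡⟨ lem₁ P F (+ w) ⟩
      + 3 ℤ.* (P ℤ.* F) ℤ.* (+ 56 ℤ.* (+ w ℤ.* + w))
        ≤⟨ ℤ.*-monoˡ-≤-nonNeg (+ 3 ℤ.* (P ℤ.* F)) {{ℤ.nonNegative (0≤i*j (0≤+ 3) (0≤i*j (0≤+ p) (0≤+ (fib (suc n)))))}} wide ⟩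
      + 3 ℤ.* (P ℤ.* F) ℤ.* (+ 9 ℤ.* G)
        ≡⟨ lem₂ P F G ⟩
      + 27 ℤ.* (P ℤ.* (F ℤ.* G))
        ≤⟨ ℤ.*-monoˡ-≤-nonNeg (+ 27) (ℤ.*-monoˡ-≤-nonNeg P (parabola-lower 8≤n w)) ⟩
      + 27 ℤ.* (P ℤ.* (+ 8 ℤ.* E))
        ≡⟨ lem₃ P E ⟩
      + 72 ℤ.* (+ 3 ℤ.* (P ℤ.* E))
        ≤⟨ ℤ.*-monoˡ-≤-nonNeg (+ 72) (3p*parabola≤4Bw³ mean w) ⟩
      + 72 ℤ.* (+ 4 ℤ.* (+ B ℤ.* (+ w ℤ.* + w ℤ.* + w)))
        ≡⟨ lem₄ (+ B) (+ w) ⟩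
      + 24 ℤ.* (+ w ℤ.* + w) ℤ.* (+ 12 ℤ.* (+ w ℤ.* + B)) ∎)))
    where
    open ℤ.≤-Reasoning
    E G : ℤ
    E = tilings n (Window.parabola mean w)
    G = + 8 ℤ.* (+ w ℤ.* + w) ℤ.- + n ℤ.- + 8
    cast₁ : + (7 * (p * fib (suc n))) ≡ + 7 ℤ.* (P ℤ.* F)
    cast₁ = trans (ℤ.pos-* 7 (p * fib (suc n))) (cong (λ z → + 7 ℤ.* z) (ℤ.pos-* p (fib (suc n))))
    cast₂ : + (12 * (w * B)) ≡ + 12 ℤ.* (+ w ℤ.* + B)
    cast₂ = trans (ℤ.pos-* 12 (w * B)) (cong (λ z → + 12 ℤ.* z) (ℤ.pos-* w B))
    positive : ℤ.Positive (+ 24 ℤ.* (+ w ℤ.* + w))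
    positive = ℤ.positive (subst (0ℤ ℤ.<_) (trans (ℤ.pos-* 24 (w * w)) (cong (λ z → + 24 ℤ.* z) (ℤ.pos-* w w)))
      (ℤ.+<+ (*-mono-≤ {1} {24} (s≤s z≤n) (*-mono-≤ {1} {w} (≤-trans (s≤s z≤n) 5≤w) (≤-trans (s≤s z≤n) 5≤w)))))
    lem₁ : ∀ P F w → + 24 ℤ.* (w ℤ.* w) ℤ.* (+ 7 ℤ.* (P ℤ.* F)) ≡ + 3 ℤ.* (P ℤ.* F) ℤ.* (+ 56 ℤ.* (w ℤ.* w))
    lem₁ = ℤSolver.solve-∀
    lem₂ : ∀ P F G → + 3 ℤ.* (P ℤ.* F) ℤ.* (+ 9 ℤ.* G) ≡ + 27 ℤ.* (P ℤ.* (F ℤ.* G))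
    lem₂ = ℤSolver.solve-∀
    lem₃ : ∀ P E → + 27 ℤ.* (P ℤ.* (+ 8 ℤ.* E)) ≡ + 72 ℤ.* (+ 3 ℤ.* (P ℤ.* E))
    lem₃ = ℤSolver.solve-∀
    lem₄ : ∀ B w → + 72 ℤ.* (+ 4 ℤ.* (B ℤ.* (w ℤ.* w ℤ.* w))) ≡ + 24 ℤ.* (w ℤ.* w) ℤ.* (+ 12 ℤ.* (w ℤ.* B))
    lem₄ = ℤSolver.solve-∀
    slack : ∀ w n → + 9 ℤ.* (+ 8 ℤ.* (w ℤ.* w) ℤ.- n ℤ.- + 8) ℤ.- + 56 ℤ.* (w ℤ.* w) ≡
      + 9 ℤ.* (w ℤ.* w ℤ.+ + 2 ℤ.* w ℤ.- n) ℤ.+ ((w ℤ.- + 5) ℤ.* (+ 7 ℤ.* w ℤ.+ + 17) ℤ.+ + 13)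
    slack = ℤSolver.solve-∀
    wide : + 56 ℤ.* (+ w ℤ.* + w) ℤ.≤ + 9 ℤ.* G
    wide = ≤-by-difference (slack (+ w) (+ n)) (0≤i+j
      (0≤i*j (0≤+ 9) (ℤ.i≤j⇒0≤j-i (subst (+ n ℤ.≤_) (cong₂ ℤ._+_ (ℤ.pos-* w w) (ℤ.pos-* 2 w)) (+≤+ n≤))))
      (0≤i+j (0≤i*j (ℤ.i≤j⇒0≤j-i (+≤+ 5≤w)) (0≤i+j (0≤i*j (0≤+ 7) (0≤+ w)) (0≤+ 17))) (0≤+ 13)))

  21[pF]²≤64nB²-large : 25 ≤ n → 21 * ((p * fib (suc n)) * (p * fib (suc n))) ≤ 64 * (n * (B * B))
  21[pF]²≤64nB²-large 25≤n with ⌊√ n ⌋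
  ... | w , ww≤n , n≤ = *-cancelˡ-≤ 49 (begin
    49 * (21 * (X * X))                 ≡⟨ lem₁ X ⟩
    21 * ((7 * X) * (7 * X))            ≤⟨ *-monoʳ-≤ 21 (*-mono-≤ main main) ⟩
    21 * ((12 * (w * B)) * (12 * (w * B))) ≡⟨ lem₂ w B ⟩
    -- The constant 12/7 is small enough: 21 · 12² = 3024 ≤ 3136 = 64 · 7².
    3024 * ((w * w) * (B * B))          ≤⟨ *-mono-≤ (m≤m+n 3024 112) (*-monoˡ-≤ (B * B) ww≤n) ⟩
    3136 * (n * (B * B))                ≡⟨ *-assoc 49 64 (n * (B * B)) ⟩
    49 * (64 * (n * (B * B)))           ∎)
    where
    open ≤-Reasoning
    X : ℕ
    X = p * fib (suc n)
    -- The threshold 25 enters here: w ≤ 4 would give n ≤ 16 + 8.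
    5≤w : 5 ≤ w
    5≤w with 5 ≤? w
    ... | yes 5≤w = 5≤w
    ... | no 5≰w = contradiction (≤-trans 25≤n (≤-trans n≤ (+-mono-≤ (*-mono-≤ w≤4 w≤4) (*-monoʳ-≤ 2 w≤4)))) (<⇒≱ ≤-refl)
      where
      w≤4 : w ≤ 4
      w≤4 = ≤-pred (≰⇒> 5≰w)
    main : 7 * X ≤ 12 * (w * B)
    main = 7pF≤12wB (≤-trans (m≤m+n 8 17) 25≤n) 5≤w n≤
    lem₁ : ∀ X → 49 * (21 * (X * X)) ≡ 21 * ((7 * X) * (7 * X))
    lem₁ = solve-∀
    lem₂ : ∀ w B → 21 * ((12 * (w * B)) * (12 * (w * B))) ≡ 3024 * ((w * w) * (B * B))
    lem₂ = solve-∀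

  -- For small n a single m is enough, provided that C(n-m,m) is a large enough share of F_{n+1};
  -- this is a numerical condition free of `p` and `B`.
  21[pF]²≤64nB²-by : ∀ {m} → m ≤ n → 21 * (fib (suc n) * fib (suc n)) ≤ 64 * (n * (((n ∸ m) C m) * ((n ∸ m) C m))) →
    21 * ((p * fib (suc n)) * (p * fib (suc n))) ≤ 64 * (n * (B * B))
  21[pF]²≤64nB²-by {m} m≤n bound = begin
    21 * ((p * f) * (p * f))            ≡⟨ lem₁ p f ⟩
    (p * p) * (21 * (f * f))            ≤⟨ *-monoʳ-≤ (p * p) bound ⟩
    (p * p) * (64 * (n * (a * a)))      ≡⟨ lem₂ p n a ⟩
    64 * (n * ((p * a) * (p * a)))      ≤⟨ *-monoʳ-≤ 64 (*-monoʳ-≤ n (*-mono-≤ (tiling-bound m m≤n) (tiling-bound m m≤n))) ⟩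
    64 * (n * (B * B))                  ∎
    where
    open ≤-Reasoning
    f a : ℕ
    f = fib (suc n)
    a = (n ∸ m) C m
    lem₁ : ∀ p f → 21 * ((p * f) * (p * f)) ≡ (p * p) * (21 * (f * f))
    lem₁ = solve-∀
    lem₂ : ∀ p n a → (p * p) * (64 * (n * (a * a))) ≡ 64 * (n * ((p * a) * (p * a)))
    lem₂ = solve-∀

-- (n + 2) / 4 is close enough to the most frequent number of dominoes for n ≤ 24.
small-tilings : ∀ {k} → k < 24 → let n = suc k; a = (n ∸ (n + 2) / 4) C ((n + 2) / 4) in
  21 * (fib (suc n) * fib (suc n)) ≤ 64 * (n * (a * a))
small-tilings = toWitness {a? = allUpTo? (λ k → let n = suc k; a = (n ∸ (n + 2) / 4) C ((n + 2) / 4) in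
  21 * (fib (suc n) * fib (suc n)) ≤? 64 * (n * (a * a))) 24} _

small-index : ∀ {k} → k < 24 → (suc k + 2) / 4 ≤ suc k
small-index = toWitness {a? = allUpTo? (λ k → (suc k + 2) / 4 ≤? suc k) 24} _

21[pF]²≤64nB² : ∀ {n p B} → 1 ≤ n → (∀ m → m ≤ n → p * ((n ∸ m) C m) ≤ B) →
  21 * ((p * fib (suc n)) * (p * fib (suc n))) ≤ 64 * (n * (B * B))
21[pF]²≤64nB² {suc k} {p} _ tiling-bound with k <? 24
... | yes k<24 = 21[pF]²≤64nB²-by {p = p} tiling-bound (small-index k<24) (small-tilings k<24)
... | no  k≮24 = 21[pF]²≤64nB²-large {p = p} tiling-bound (s≤s (≮⇒≥ k≮24))

-- The ring ℤ[√5]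

√5+1 : ℤ√5
√5+1 = 1ℤ + 1ℤ √5

*√-assoc : ∀ x y z → (x *√ y) *√ z ≡ x *√ (y *√ z)
*√-assoc (a + b √5) (c + d √5) (e + f √5) = cong₂ _+_√5 (real a b c d e f) (imag a b c d e f)
  where
  real : ∀ a b c d e f →
    (a ℤ.* c ℤ.+ + 5 ℤ.* b ℤ.* d) ℤ.* e ℤ.+ + 5 ℤ.* (a ℤ.* d ℤ.+ b ℤ.* c) ℤ.* f ≡
    a ℤ.* (c ℤ.* e ℤ.+ + 5 ℤ.* d ℤ.* f) ℤ.+ + 5 ℤ.* b ℤ.* (c ℤ.* f ℤ.+ d ℤ.* e)
  real = ℤSolver.solve-∀
  imag : ∀ a b c d e f →
    (a ℤ.* c ℤ.+ + 5 ℤ.* b ℤ.* d) ℤ.* f ℤ.+ (a ℤ.* d ℤ.+ b ℤ.* c) ℤ.* e ≡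
    a ℤ.* (c ℤ.* f ℤ.+ d ℤ.* e) ℤ.+ b ℤ.* (c ℤ.* e ℤ.+ + 5 ℤ.* d ℤ.* f)
  imag = ℤSolver.solve-∀

*√-comm : ∀ x y → x *√ y ≡ y *√ x
*√-comm (a + b √5) (c + d √5) = cong₂ _+_√5 (real a b c d) (imag a b c d)
  where
  real : ∀ a b c d → a ℤ.* c ℤ.+ + 5 ℤ.* b ℤ.* d ≡ c ℤ.* a ℤ.+ + 5 ℤ.* d ℤ.* b
  real = ℤSolver.solve-∀
  imag : ∀ a b c d → a ℤ.* d ℤ.+ b ℤ.* c ≡ c ℤ.* b ℤ.+ d ℤ.* a
  imag = ℤSolver.solve-∀

*√-identityˡ : ∀ x → ι 1 *√ x ≡ x
*√-identityˡ (a + b √5) = cong₂ _+_√5 (real a b) (imag a b)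
  where
  real : ∀ a b → 1ℤ ℤ.* a ℤ.+ + 5 ℤ.* 0ℤ ℤ.* b ≡ a
  real = ℤSolver.solve-∀
  imag : ∀ a b → 1ℤ ℤ.* b ℤ.+ 0ℤ ℤ.* a ≡ b
  imag = ℤSolver.solve-∀

*√-distribˡ--√ : ∀ x y z → x *√ (y -√ z) ≡ x *√ y -√ x *√ z
*√-distribˡ--√ (a + b √5) (c + d √5) (e + f √5) = cong₂ _+_√5 (real a b c d e f) (imag a b c d e f)
  where
  real : ∀ a b c d e f → a ℤ.* (c ℤ.- e) ℤ.+ + 5 ℤ.* b ℤ.* (d ℤ.- f) ≡
    (a ℤ.* c ℤ.+ + 5 ℤ.* b ℤ.* d) ℤ.- (a ℤ.* e ℤ.+ + 5 ℤ.* b ℤ.* f)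
  real = ℤSolver.solve-∀
  imag : ∀ a b c d e f → a ℤ.* (d ℤ.- f) ℤ.+ b ℤ.* (c ℤ.- e) ≡
    (a ℤ.* d ℤ.+ b ℤ.* c) ℤ.- (a ℤ.* f ℤ.+ b ℤ.* e)
  imag = ℤSolver.solve-∀

*√-commutativeSemigroup : CommutativeSemigroup _ _
*√-commutativeSemigroup = record
  { Carrier = ℤ√5 ; _≈_ = _≡_ ; _∙_ = _*√_
  ; isCommutativeSemigroup = record
    { isSemigroup = record
      { isMagma = record { isEquivalence = isEquivalence ; ∙-cong = cong₂ _*√_ }
      ; assoc = *√-assoc }
    ; comm = *√-comm } }

open CommutativeSemigroupProperties *√-commutativeSemigroup
  using (interchange; x∙yz≈y∙xz)

ι-*-components : ∀ k a b → ι k *√ (a + b √5) ≡ (+ k ℤ.* a) + (+ k ℤ.* b) √5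
ι-*-components k a b = cong₂ _+_√5 (real (+ k) a b) (imag (+ k) a b)
  where
  real : ∀ k a b → k ℤ.* a ℤ.+ + 5 ℤ.* 0ℤ ℤ.* b ≡ k ℤ.* a
  real = ℤSolver.solve-∀
  imag : ∀ k a b → k ℤ.* b ℤ.+ 0ℤ ℤ.* a ≡ k ℤ.* b
  imag = ℤSolver.solve-∀

ι-* : ∀ a b → ι (a * b) ≡ ι a *√ ι b
ι-* a b = trans (cong₂ _+_√5 (ℤ.pos-* a b) (sym (ℤ.*-zeroʳ (+ a)))) (sym (ι-*-components a (+ b) 0ℤ))

^√-distribˡ-+ : ∀ x m n → x ^√ (m + n) ≡ x ^√ m *√ x ^√ n
^√-distribˡ-+ x zero    n = sym (*√-identityˡ (x ^√ n))
^√-distribˡ-+ x (suc m) n = trans (cong (x *√_) (^√-distribˡ-+ x m n)) (sym (*√-assoc x (x ^√ m) (x ^√ n)))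

conjugate-powers : ∀ n → √5-1 ^√ n *√ √5+1 ^√ n ≡ ι (4 ^ n)
conjugate-powers zero    = refl
conjugate-powers (suc n) = trans (interchange √5-1 (√5-1 ^√ n) √5+1 (√5+1 ^√ n))
  (trans (cong (ι 4 *√_) (conjugate-powers n)) (sym (ι-* 4 (4 ^ n))))

-- Multiplication by √5 - 1 multiplies the norm a² - 5b² by -4, so it interchanges the two
-- mixed-sign cases of `NonNeg`; only a, b ≥ 0 has to be split further. Restricting to this one
-- factor avoids the case analysis of a general product.
NonNeg-√5-1-* : ∀ {y} → NonNeg y → NonNeg (√5-1 *√ y)
NonNeg-√5-1-* {a + b √5} = subst NonNeg (sym components) ∘ signs
  where
  components : √5-1 *√ (a + b √5) ≡ (+ 5 ℤ.* b ℤ.- a) + (a ℤ.- b) √5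
  components = cong₂ _+_√5 (real a b) (imag a b)
    where
    real : ∀ a b → -1ℤ ℤ.* a ℤ.+ + 5 ℤ.* 1ℤ ℤ.* b ≡ + 5 ℤ.* b ℤ.- a
    real = ℤSolver.solve-∀
    imag : ∀ a b → -1ℤ ℤ.* b ℤ.+ 1ℤ ℤ.* a ≡ a ℤ.- b
    imag = ℤSolver.solve-∀
  A B : ℤ
  A = + 5 ℤ.* b ℤ.- a
  B = a ℤ.- b
  norm₁ : ∀ a b → + 5 ℤ.* (a ℤ.- b) ℤ.* (a ℤ.- b) ℤ.- (+ 5 ℤ.* b ℤ.- a) ℤ.* (+ 5 ℤ.* b ℤ.- a) ≡
    + 4 ℤ.* (a ℤ.* a ℤ.- + 5 ℤ.* b ℤ.* b)
  norm₁ = ℤSolver.solve-∀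
  norm₂ : ∀ a b → (+ 5 ℤ.* b ℤ.- a) ℤ.* (+ 5 ℤ.* b ℤ.- a) ℤ.- + 5 ℤ.* (a ℤ.- b) ℤ.* (a ℤ.- b) ≡
    + 4 ℤ.* (+ 5 ℤ.* b ℤ.* b ℤ.- a ℤ.* a)
  norm₂ = ℤSolver.solve-∀
  AA≤5BB : + 5 ℤ.* b ℤ.* b ℤ.≤ a ℤ.* a → A ℤ.* A ℤ.≤ + 5 ℤ.* B ℤ.* B
  AA≤5BB le = ≤-by-difference (norm₁ a b) (0≤i*j (0≤+ 4) (ℤ.i≤j⇒0≤j-i le))
  5BB≤AA : a ℤ.* a ℤ.≤ + 5 ℤ.* b ℤ.* b → + 5 ℤ.* B ℤ.* B ℤ.≤ A ℤ.* A
  5BB≤AA le = ≤-by-difference (norm₂ a b) (0≤i*j (0≤+ 4) (ℤ.i≤j⇒0≤j-i le))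
  b≤5b : 0ℤ ℤ.≤ b → b ℤ.≤ + 5 ℤ.* b
  b≤5b 0≤b = ≤-by-difference (lem b) (0≤i*j (0≤+ 4) 0≤b)
    where
    lem : ∀ b → + 5 ℤ.* b ℤ.- b ≡ + 4 ℤ.* b
    lem = ℤSolver.solve-∀
  5b≤0 : b ℤ.≤ 0ℤ → + 5 ℤ.* b ℤ.≤ 0ℤ
  5b≤0 = ℤ.*-monoˡ-≤-nonNeg (+ 5)
  0≤5b : 0ℤ ℤ.≤ b → 0ℤ ℤ.≤ + 5 ℤ.* b
  0≤5b = 0≤i*j (0≤+ 5)
  signs : NonNeg (a + b √5) → NonNeg (A + B √5)
  signs (inj₂ (inj₁ (0≤a , b≤0 , le))) = inj₂ (inj₂
    (ℤ.i≤j⇒i-j≤0 (ℤ.≤-trans (5b≤0 b≤0) 0≤a) , ℤ.i≤j⇒0≤j-i (ℤ.≤-trans b≤0 0≤a) , AA≤5BB le))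
  signs (inj₂ (inj₂ (a≤0 , 0≤b , le))) = inj₂ (inj₁
    (ℤ.i≤j⇒0≤j-i (ℤ.≤-trans a≤0 (0≤5b 0≤b)) , ℤ.i≤j⇒i-j≤0 (ℤ.≤-trans a≤0 0≤b) , 5BB≤AA le))
  signs (inj₁ (0≤a , 0≤b)) with ℤ.≤-total (+ 5 ℤ.* b) a | ℤ.≤-total a b
  ... | inj₁ 5b≤a | _ = inj₂ (inj₂
    (ℤ.i≤j⇒i-j≤0 5b≤a , ℤ.i≤j⇒0≤j-i (ℤ.≤-trans (b≤5b 0≤b) 5b≤a) , AA≤5BB 5bb≤aa))
    where
    5bb≤aa : + 5 ℤ.* b ℤ.* b ℤ.≤ a ℤ.* a
    5bb≤aa = ℤ.≤-trans (ℤ.*-monoʳ-≤-nonNeg b {{ℤ.nonNegative 0≤b}} 5b≤a)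
                       (ℤ.*-monoˡ-≤-nonNeg a {{ℤ.nonNegative 0≤a}} (ℤ.≤-trans (b≤5b 0≤b) 5b≤a))
  ... | inj₂ a≤5b | inj₂ b≤a = inj₁ (ℤ.i≤j⇒0≤j-i a≤5b , ℤ.i≤j⇒0≤j-i b≤a)
  ... | inj₂ a≤5b | inj₁ a≤b = inj₂ (inj₁
    (ℤ.i≤j⇒0≤j-i a≤5b , ℤ.i≤j⇒i-j≤0 a≤b , 5BB≤AA aa≤5bb))
    where
    aa≤5bb : a ℤ.* a ℤ.≤ + 5 ℤ.* b ℤ.* b
    aa≤5bb = ℤ.≤-trans (ℤ.*-monoʳ-≤-nonNeg a {{ℤ.nonNegative 0≤a}} a≤5b)
                       (ℤ.*-monoˡ-≤-nonNeg (+ 5 ℤ.* b) {{ℤ.nonNegative (0≤5b 0≤b)}} a≤b)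

NonNeg-√5-1^-* : ∀ k {y} → NonNeg y → NonNeg (√5-1 ^√ k *√ y)
NonNeg-√5-1^-* zero    {y} 0≤y = subst NonNeg (sym (*√-identityˡ y)) 0≤y
NonNeg-√5-1^-* (suc k) {y} 0≤y = subst NonNeg (sym (*√-assoc √5-1 (√5-1 ^√ k) y)) (NonNeg-√5-1-* (NonNeg-√5-1^-* k 0≤y))

NonNeg-cancel-ι : ∀ k .{{_ : NonZero k}} {y} → NonNeg (ι k *√ y) → NonNeg y
NonNeg-cancel-ι k@(suc _) {a + b √5} = cancel ∘ subst NonNeg (ι-*-components k a b)
  where
  K : ℤ
  K = + k
  0≤-cancel : ∀ i → 0ℤ ℤ.≤ K ℤ.* i → 0ℤ ℤ.≤ i
  0≤-cancel i le = ℤ.*-cancelˡ-≤-pos 0ℤ i K (ℤ.≤-trans (ℤ.≤-reflexive (ℤ.*-zeroʳ K)) le)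
  ≤0-cancel : ∀ i → K ℤ.* i ℤ.≤ 0ℤ → i ℤ.≤ 0ℤ
  ≤0-cancel i le = ℤ.*-cancelˡ-≤-pos i 0ℤ K (ℤ.≤-trans le (ℤ.≤-reflexive (sym (ℤ.*-zeroʳ K))))
  lem₁ : ∀ k b → + 5 ℤ.* (k ℤ.* b) ℤ.* (k ℤ.* b) ≡ k ℤ.* (k ℤ.* (+ 5 ℤ.* b ℤ.* b))
  lem₁ = ℤSolver.solve-∀
  lem₂ : ∀ k a → (k ℤ.* a) ℤ.* (k ℤ.* a) ≡ k ℤ.* (k ℤ.* (a ℤ.* a))
  lem₂ = ℤSolver.solve-∀
  ≤-cancel² : ∀ i j → K ℤ.* (K ℤ.* i) ℤ.≤ K ℤ.* (K ℤ.* j) → i ℤ.≤ j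
  ≤-cancel² i j = ℤ.*-cancelˡ-≤-pos i j K ∘ ℤ.*-cancelˡ-≤-pos (K ℤ.* i) (K ℤ.* j) K
  cancel : NonNeg ((K ℤ.* a) + (K ℤ.* b) √5) → NonNeg (a + b √5)
  cancel (inj₁ (0≤a , 0≤b)) = inj₁ (0≤-cancel a 0≤a , 0≤-cancel b 0≤b)
  cancel (inj₂ (inj₁ (0≤a , b≤0 , le))) = inj₂ (inj₁ (0≤-cancel a 0≤a , ≤0-cancel b b≤0 ,
    ≤-cancel² (+ 5 ℤ.* b ℤ.* b) (a ℤ.* a) (subst₂ ℤ._≤_ (lem₁ K b) (lem₂ K a) le)))
  cancel (inj₂ (inj₂ (a≤0 , 0≤b , le))) = inj₂ (inj₂ (≤0-cancel a a≤0 , 0≤-cancel b 0≤b ,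
    ≤-cancel² (a ℤ.* a) (+ 5 ℤ.* b ℤ.* b) (subst₂ ℤ._≤_ (lem₂ K a) (lem₁ K b) le)))

-- Division is replaced by multiplication with the power of √5 - 1, which turns the factor into the
-- positive integer 4ᵏ.
NonNeg-cancel-√5+1^ : ∀ k {y} → NonNeg (√5+1 ^√ k *√ y) → NonNeg y
NonNeg-cancel-√5+1^ k {y} = NonNeg-cancel-ι (4 ^ k) {{m^n≢0 4 k}}
  ∘ subst NonNeg (trans (sym (*√-assoc (√5-1 ^√ k) (√5+1 ^√ k) y)) (cong (_*√ y) (conjugate-powers k)))
  ∘ NonNeg-√5-1^-* k

-- 2φᵏ⁺¹, where φ = (1 + √5)/2
2φ^1+ : ℕ → ℤ√5
2φ^1+ k = (+ fib (suc k) ℤ.+ + 2 ℤ.* + fib k) + (+ fib (suc k)) √5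

-- As √5 + 1 = 2φ, this is a power of 2φ; the extra 2 is there because the coordinates of powers of
-- φ may be half-integers.
√5+1-power : ∀ k → ι 2 *√ √5+1 ^√ suc k ≡ ι (2 ^ suc k) *√ 2φ^1+ k
√5+1-power zero    = refl
√5+1-power (suc k) = begin
  ι 2 *√ (√5+1 *√ √5+1 ^√ suc k)          ≡⟨ x∙yz≈y∙xz (ι 2) √5+1 (√5+1 ^√ suc k) ⟩
  √5+1 *√ (ι 2 *√ √5+1 ^√ suc k)          ≡⟨ cong (√5+1 *√_) (√5+1-power k) ⟩
  √5+1 *√ (ι (2 ^ suc k) *√ 2φ^1+ k)      ≡⟨ x∙yz≈y∙xz √5+1 (ι (2 ^ suc k)) (2φ^1+ k) ⟩
  ι (2 ^ suc k) *√ (√5+1 *√ 2φ^1+ k)      ≡⟨ cong (ι (2 ^ suc k) *√_) (step (+ fib (suc k)) (+ fib k)) ⟩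
  ι (2 ^ suc k) *√ (ι 2 *√ 2φ^1+ (suc k)) ≡⟨ *√-assoc (ι (2 ^ suc k)) (ι 2) (2φ^1+ (suc k)) ⟨
  ι (2 ^ suc k) *√ ι 2 *√ 2φ^1+ (suc k)   ≡⟨ cong (_*√ 2φ^1+ (suc k)) (ι-* (2 ^ suc k) 2) ⟨
  ι (2 ^ suc k * 2) *√ 2φ^1+ (suc k)      ≡⟨ cong (λ m → ι m *√ 2φ^1+ (suc k)) (*-comm (2 ^ suc k) 2) ⟩
  ι (2 ^ suc (suc k)) *√ 2φ^1+ (suc k)    ∎
  where
  open ≡-Reasoning
  step : ∀ f h → √5+1 *√ ((f ℤ.+ + 2 ℤ.* h) + f √5) ≡ ι 2 *√ (((f ℤ.+ h) ℤ.+ + 2 ℤ.* f) + (f ℤ.+ h) √5)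
  step f h = cong₂ _+_√5 (real f h) (imag f h)
    where
    real : ∀ f h → 1ℤ ℤ.* (f ℤ.+ + 2 ℤ.* h) ℤ.+ + 5 ℤ.* 1ℤ ℤ.* f ≡
      + 2 ℤ.* ((f ℤ.+ h) ℤ.+ + 2 ℤ.* f) ℤ.+ + 5 ℤ.* 0ℤ ℤ.* (f ℤ.+ h)
    real = ℤSolver.solve-∀
    imag : ∀ f h → 1ℤ ℤ.* f ℤ.+ 1ℤ ℤ.* (f ℤ.+ + 2 ℤ.* h) ≡
      + 2 ℤ.* (f ℤ.+ h) ℤ.+ 0ℤ ℤ.* ((f ℤ.+ h) ℤ.+ + 2 ℤ.* f)
    imag = ℤSolver.solve-∀

4^n≡2^n*2^n : ∀ n → 4 ^ n ≡ 2 ^ n * 2 ^ n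
4^n≡2^n*2^n n = trans (^-*-assoc 2 2 n) (trans (cong (2 ^_) (cong (λ z → n + z) (+-identityʳ n))) (^-distribˡ-+-* 2 n n))

-- The lower bound in ℤ[√5]

module _ {n p : ℕ} (bound : ∀ k → 2 ^ n * fib (suc k + n) ≤ p * fib (suc k + 2 * n)) where

  private
    K : ℕ
    K = 2 + 2 * n
    D : ℤ√5
    D = ι p *√ 2φ^1+ (1 + 2 * n) -√ ι (2 ^ n) *√ 2φ^1+ (1 + n)

  NonNeg-D : NonNeg (ι (2 ^ K) *√ D)
  NonNeg-D = subst NonNeg
    (sym (trans (cong (ι (2 ^ K) *√_) (cong₂ _-√_ (ι-*-components p (f₂ ℤ.+ + 2 ℤ.* f₁) f₂) (ι-*-components (2 ^ n) (h₂ ℤ.+ + 2 ℤ.* h₁) h₂)))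
      (ι-*-components (2 ^ K) _ _)))
    -- The coordinate of √5 in `D` is nonnegative by the case k = 1 of `bound`; the rational
    -- coordinate is that same number plus twice the difference from k = 0.
    (inj₁ ( 0≤i*j (0≤+ (2 ^ K)) (subst (0ℤ ℤ.≤_) (sym (lem (+ p) (+ (2 ^ n)) f₁ f₂ h₁ h₂)) (0≤i+j imag (0≤i*j (0≤+ 2) real)))
          , 0≤i*j (0≤+ (2 ^ K)) imag))
    where
    f₁ f₂ h₁ h₂ : ℤ
    f₁ = + fib (1 + 2 * n)
    f₂ = + fib (2 + 2 * n)
    h₁ = + fib (1 + n)
    h₂ = + fib (2 + n)
    lem : ∀ p q f₁ f₂ h₁ h₂ → p ℤ.* (f₂ ℤ.+ + 2 ℤ.* f₁) ℤ.- q ℤ.* (h₂ ℤ.+ + 2 ℤ.* h₁) ≡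
      (p ℤ.* f₂ ℤ.- q ℤ.* h₂) ℤ.+ + 2 ℤ.* (p ℤ.* f₁ ℤ.- q ℤ.* h₁)
    lem = ℤSolver.solve-∀
    real : 0ℤ ℤ.≤ + p ℤ.* f₁ ℤ.- + (2 ^ n) ℤ.* h₁
    real = ℤ.i≤j⇒0≤j-i (subst₂ ℤ._≤_ (ℤ.pos-* (2 ^ n) _) (ℤ.pos-* p _) (+≤+ (bound 0)))
    imag : 0ℤ ℤ.≤ + p ℤ.* f₂ ℤ.- + (2 ^ n) ℤ.* h₂
    imag = ℤ.i≤j⇒0≤j-i (subst₂ ℤ._≤_ (ℤ.pos-* (2 ^ n) _) (ℤ.pos-* p _) (+≤+ (bound 1)))

  -- The exponent K = (n + 2) + n lets n factors √5 + 1 cancel against the power of √5 - 1, leaving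
  -- 4ⁿ (√5 + 1)^(n+2) = 2ᴷ 2ⁿ φ^(n+2).
  scaled-difference : ι 2 *√ (√5+1 ^√ K *√ (ι p -√ √5-1 ^√ n)) ≡ ι (2 ^ K) *√ D
  scaled-difference = begin
    ι 2 *√ (√5+1 ^√ K *√ (ι p -√ √5-1 ^√ n))
      ≡⟨ *√-assoc (ι 2) (√5+1 ^√ K) (ι p -√ √5-1 ^√ n) ⟨
    ι 2 *√ √5+1 ^√ K *√ (ι p -√ √5-1 ^√ n)
      ≡⟨ *√-distribˡ--√ (ι 2 *√ √5+1 ^√ K) (ι p) (√5-1 ^√ n) ⟩
    ι 2 *√ √5+1 ^√ K *√ ι p -√ ι 2 *√ √5+1 ^√ K *√ √5-1 ^√ n
      ≡⟨ cong₂ _-√_ left right ⟩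
    ι (2 ^ K) *√ (ι p *√ 2φ^1+ (1 + 2 * n)) -√ ι (2 ^ K) *√ (ι (2 ^ n) *√ 2φ^1+ (1 + n))
      ≡⟨ *√-distribˡ--√ (ι (2 ^ K)) (ι p *√ 2φ^1+ (1 + 2 * n)) (ι (2 ^ n) *√ 2φ^1+ (1 + n)) ⟨
    ι (2 ^ K) *√ D ∎
    where
    open ≡-Reasoning
    left : ι 2 *√ √5+1 ^√ K *√ ι p ≡ ι (2 ^ K) *√ (ι p *√ 2φ^1+ (1 + 2 * n))
    left = trans (cong (_*√ ι p) (√5+1-power (1 + 2 * n)))
      (trans (*√-assoc (ι (2 ^ K)) (2φ^1+ (1 + 2 * n)) (ι p)) (cong (ι (2 ^ K) *√_) (*√-comm (2φ^1+ (1 + 2 * n)) (ι p))))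
    K≡ : K ≡ (2 + n) + n
    K≡ = cong (λ z → 2 + z) (cong (λ z → n + z) (+-identityʳ n))
    powers : 2 ^ (2 + n) * 4 ^ n ≡ 2 ^ K * 2 ^ n
    powers = trans (cong (2 ^ (2 + n) *_) (4^n≡2^n*2^n n)) (trans (sym (*-assoc (2 ^ (2 + n)) (2 ^ n) (2 ^ n)))
      (cong (_* 2 ^ n) (trans (sym (^-distribˡ-+-* 2 (2 + n) n)) (cong (2 ^_) (sym K≡)))))
    right : ι 2 *√ √5+1 ^√ K *√ √5-1 ^√ n ≡ ι (2 ^ K) *√ (ι (2 ^ n) *√ 2φ^1+ (1 + n))
    right = begin
      ι 2 *√ √5+1 ^√ K *√ √5-1 ^√ n
        ≡⟨ cong (λ x → ι 2 *√ x *√ √5-1 ^√ n) (trans (cong (√5+1 ^√_) K≡) (^√-distribˡ-+ √5+1 (2 + n) n)) ⟩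
      ι 2 *√ (√5+1 ^√ (2 + n) *√ √5+1 ^√ n) *√ √5-1 ^√ n
        ≡⟨ cong (_*√ √5-1 ^√ n) (*√-assoc (ι 2) (√5+1 ^√ (2 + n)) (√5+1 ^√ n)) ⟨
      ι 2 *√ √5+1 ^√ (2 + n) *√ √5+1 ^√ n *√ √5-1 ^√ n
        ≡⟨ *√-assoc (ι 2 *√ √5+1 ^√ (2 + n)) (√5+1 ^√ n) (√5-1 ^√ n) ⟩
      ι 2 *√ √5+1 ^√ (2 + n) *√ (√5+1 ^√ n *√ √5-1 ^√ n)
        ≡⟨ cong₂ _*√_ (√5+1-power (1 + n)) (trans (*√-comm (√5+1 ^√ n) (√5-1 ^√ n)) (conjugate-powers n)) ⟩
      ι (2 ^ (2 + n)) *√ 2φ^1+ (1 + n) *√ ι (4 ^ n)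
        ≡⟨ *√-assoc (ι (2 ^ (2 + n))) (2φ^1+ (1 + n)) (ι (4 ^ n)) ⟩
      ι (2 ^ (2 + n)) *√ (2φ^1+ (1 + n) *√ ι (4 ^ n))
        ≡⟨ cong (ι (2 ^ (2 + n)) *√_) (*√-comm (2φ^1+ (1 + n)) (ι (4 ^ n))) ⟩
      ι (2 ^ (2 + n)) *√ (ι (4 ^ n) *√ 2φ^1+ (1 + n))
        ≡⟨ *√-assoc (ι (2 ^ (2 + n))) (ι (4 ^ n)) (2φ^1+ (1 + n)) ⟨
      ι (2 ^ (2 + n)) *√ ι (4 ^ n) *√ 2φ^1+ (1 + n)
        ≡⟨ cong (_*√ 2φ^1+ (1 + n)) (trans (sym (ι-* (2 ^ (2 + n)) (4 ^ n))) (trans (cong ι powers) (ι-* (2 ^ K) (2 ^ n)))) ⟩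
      ι (2 ^ K) *√ ι (2 ^ n) *√ 2φ^1+ (1 + n)
        ≡⟨ *√-assoc (ι (2 ^ K)) (ι (2 ^ n)) (2φ^1+ (1 + n)) ⟩
      ι (2 ^ K) *√ (ι (2 ^ n) *√ 2φ^1+ (1 + n)) ∎

  √5-1^n≤p : √5-1 ^√ n ≤√ ι p
  √5-1^n≤p = NonNeg-cancel-√5+1^ K (NonNeg-cancel-ι 2 (subst NonNeg (sym scaled-difference) NonNeg-D))

-- √5 ≤ 9/4
NonNeg-9/4 : ∀ {X Z} → 0ℤ ℤ.≤ Z → + 9 ℤ.* Z ℤ.≤ + 4 ℤ.* X → NonNeg (X + (ℤ.- Z) √5)
NonNeg-9/4 {X} {Z} 0≤Z 9Z≤4X = inj₂ (inj₁ (0≤X , ℤ.neg-mono-≤ 0≤Z ,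
  ℤ.*-cancelˡ-≤-pos _ _ (+ 16) (≤-by-difference (identity X Z)
    (0≤i+j (0≤i*j (ℤ.i≤j⇒0≤j-i 9Z≤4X) (0≤i+j (0≤i*j (0≤+ 4) 0≤X) (0≤i*j (0≤+ 9) 0≤Z))) (0≤i*j 0≤Z 0≤Z)))))
  where
  0≤X : 0ℤ ℤ.≤ X
  0≤X = ℤ.*-cancelˡ-≤-pos 0ℤ X (+ 4) (ℤ.≤-trans (0≤i*j (0≤+ 9) 0≤Z) 9Z≤4X)
  identity : ∀ X Z → + 16 ℤ.* (X ℤ.* X) ℤ.- + 16 ℤ.* (+ 5 ℤ.* (ℤ.- Z) ℤ.* (ℤ.- Z)) ≡
    (+ 4 ℤ.* X ℤ.- + 9 ℤ.* Z) ℤ.* (+ 4 ℤ.* X ℤ.+ + 9 ℤ.* Z) ℤ.+ Z ℤ.* Z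
  identity = ℤSolver.solve-∀

-- The upper bound in ℤ[√5]

module _ {k p : ℕ}
         (bound : 21 * ((p * fib (2 + k)) * (p * fib (2 + k))) ≤ 64 * (suc k * ((suc k * 2 ^ suc k) * (suc k * 2 ^ suc k)))) where

  private
    n : ℕ
    n = suc k
    -- Multiplied by 4 (√5 + 1)²ⁿ = 4ⁿ (2φⁿ)², the two sides p² and (2n)³ (√5 - 1)²ⁿ become q (2φⁿ)²
    -- and M.
    q M f h : ℕ
    q = p * p * 4 ^ n
    M = 4 * ((2 * n) ^ 3 * 4 ^ (2 * n))
    f = fib n
    h = fib k

  42qF²≤4M : q * (42 * ((f + h) * (f + h))) ≤ 4 * M
  42qF²≤4M = begin
    q * (42 * ((f + h) * (f + h)))
      ≡⟨ cong (λ z → p * p * z * (42 * ((f + h) * (f + h)))) (4^n≡2^n*2^n n) ⟩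
    p * p * (b * b) * (42 * ((f + h) * (f + h)))
      ≡⟨ lem₁ p b (f + h) ⟩
    2 * (b * b) * (21 * ((p * (f + h)) * (p * (f + h))))
      ≤⟨ *-monoʳ-≤ (2 * (b * b)) bound ⟩
    2 * (b * b) * (64 * (n * ((n * b) * (n * b))))
      ≡⟨ lem₂ b n ⟩
    4 * (4 * ((2 * n) * ((2 * n) * ((2 * n) * 1)) * (b * b * (b * b))))
      ≡⟨ cong (λ z → 4 * (4 * ((2 * n) ^ 3 * z))) (sym 4^2n) ⟩
    4 * M ∎
    where
    open ≤-Reasoning
    b : ℕ
    b = 2 ^ n
    4^2n : 4 ^ (2 * n) ≡ b * b * (b * b)
    4^2n = trans (cong (λ z → 4 ^ (n + z)) (+-identityʳ n))
      (trans (^-distribˡ-+-* 4 n n) (cong₂ _*_ (4^n≡2^n*2^n n) (4^n≡2^n*2^n n)))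
    lem₁ : ∀ p b g → p * p * (b * b) * (42 * (g * g)) ≡ 2 * (b * b) * (21 * ((p * g) * (p * g)))
    lem₁ = solve-∀
    lem₂ : ∀ b n → 2 * (b * b) * (64 * (n * ((n * b) * (n * b)))) ≡
      4 * (4 * ((2 * n) * ((2 * n) * ((2 * n) * 1)) * (b * b * (b * b))))
    lem₂ = solve-∀

  -- Write (2φⁿ)² = A + B√5. By √5 ≤ 9/4, it suffices that q (4A + 9B) ≤ 4M, and 4A + 9B ≤ 42
  -- F_{n+1}² with slack 32 F H + 26 H². The slack vanishes at n = 1, where H = 0.
  NonNeg-E : NonNeg (ι M -√ ι q *√ (2φ^1+ k *√ 2φ^1+ k))
  NonNeg-E = subst NonNeg (sym components) (NonNeg-9/4 0≤qB 9qB≤4[M-qA])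
    where
    A B F H Q : ℤ
    F = + f
    H = + h
    Q = + q
    A = (F ℤ.+ + 2 ℤ.* H) ℤ.* (F ℤ.+ + 2 ℤ.* H) ℤ.+ + 5 ℤ.* F ℤ.* F
    B = (F ℤ.+ + 2 ℤ.* H) ℤ.* F ℤ.+ F ℤ.* (F ℤ.+ + 2 ℤ.* H)
    components : ι M -√ ι q *√ (2φ^1+ k *√ 2φ^1+ k) ≡ (+ M ℤ.- Q ℤ.* A) + (ℤ.- (Q ℤ.* B)) √5
    components = trans (cong (ι M -√_) (ι-*-components q A B))
      (cong ((+ M ℤ.- Q ℤ.* A) +_√5) (ℤ.+-identityˡ (ℤ.- (Q ℤ.* B))))
    0≤F+2H : 0ℤ ℤ.≤ F ℤ.+ + 2 ℤ.* H
    0≤F+2H = 0≤i+j (0≤+ f) (0≤i*j (0≤+ 2) (0≤+ h))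
    0≤qB : 0ℤ ℤ.≤ Q ℤ.* B
    0≤qB = 0≤i*j (0≤+ q) (0≤i+j (0≤i*j 0≤F+2H (0≤+ f)) (0≤i*j (0≤+ f) 0≤F+2H))
    cast : + (q * (42 * ((f + h) * (f + h)))) ≡ Q ℤ.* (+ 42 ℤ.* ((F ℤ.+ H) ℤ.* (F ℤ.+ H)))
    cast = trans (ℤ.pos-* q _) (cong (λ z → Q ℤ.* z) (trans (ℤ.pos-* 42 ((f + h) * (f + h))) (cong (λ z → + 42 ℤ.* z) (ℤ.pos-* (f + h) (f + h)))))
    0≤4M-42QF² : 0ℤ ℤ.≤ + 4 ℤ.* + M ℤ.- Q ℤ.* (+ 42 ℤ.* ((F ℤ.+ H) ℤ.* (F ℤ.+ H)))
    0≤4M-42QF² = ℤ.i≤j⇒0≤j-i (subst₂ ℤ._≤_ cast (ℤ.pos-* 4 M) (+≤+ 42qF²≤4M))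
    identity : ∀ M Q F H →
      + 4 ℤ.* (M ℤ.- Q ℤ.* ((F ℤ.+ + 2 ℤ.* H) ℤ.* (F ℤ.+ + 2 ℤ.* H) ℤ.+ + 5 ℤ.* F ℤ.* F)) ℤ.-
        + 9 ℤ.* (Q ℤ.* ((F ℤ.+ + 2 ℤ.* H) ℤ.* F ℤ.+ F ℤ.* (F ℤ.+ + 2 ℤ.* H))) ≡
      (+ 4 ℤ.* M ℤ.- Q ℤ.* (+ 42 ℤ.* ((F ℤ.+ H) ℤ.* (F ℤ.+ H)))) ℤ.+
        Q ℤ.* (+ 32 ℤ.* (F ℤ.* H) ℤ.+ + 26 ℤ.* (H ℤ.* H))
    identity = ℤSolver.solve-∀
    9qB≤4[M-qA] : + 9 ℤ.* (Q ℤ.* B) ℤ.≤ + 4 ℤ.* (+ M ℤ.- Q ℤ.* A)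
    9qB≤4[M-qA] = ≤-by-difference (identity (+ M) Q F H) (0≤i+j 0≤4M-42QF²
      (0≤i*j (0≤+ q) (0≤i+j (0≤i*j (0≤+ 32) (0≤i*j (0≤+ f) (0≤+ h))) (0≤i*j (0≤+ 26) (0≤i*j (0≤+ h) (0≤+ h))))))

  scaled-difference² : ι 4 *√ (√5+1 ^√ (2 * n) *√ (ι ((2 * n) ^ 3) *√ √5-1 ^√ (2 * n) -√ ι (p * p))) ≡
                       ι M -√ ι q *√ (2φ^1+ k *√ 2φ^1+ k)
  scaled-difference² = begin
    ι 4 *√ (u *√ (ι N *√ s -√ ι (p * p)))
      ≡⟨ cong (ι 4 *√_) (*√-distribˡ--√ u (ι N *√ s) (ι (p * p))) ⟩
    ι 4 *√ (u *√ (ι N *√ s) -√ u *√ ι (p * p))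
      ≡⟨ *√-distribˡ--√ (ι 4) (u *√ (ι N *√ s)) (u *√ ι (p * p)) ⟩
    ι 4 *√ (u *√ (ι N *√ s)) -√ ι 4 *√ (u *√ ι (p * p))
      ≡⟨ cong₂ _-√_ left right ⟩
    ι M -√ ι q *√ (φ *√ φ) ∎
    where
    open ≡-Reasoning
    N : ℕ
    N = (2 * n) ^ 3
    u s φ v : ℤ√5
    u = √5+1 ^√ (2 * n)
    s = √5-1 ^√ (2 * n)
    φ = 2φ^1+ k
    v = √5+1 ^√ n
    left : ι 4 *√ (u *√ (ι N *√ s)) ≡ ι M
    left = begin
      ι 4 *√ (u *√ (ι N *√ s))     ≡⟨ cong (ι 4 *√_) (x∙yz≈y∙xz u (ι N) s) ⟩
      ι 4 *√ (ι N *√ (u *√ s))     ≡⟨ cong (λ x → ι 4 *√ (ι N *√ x)) (trans (*√-comm u s) (conjugate-powers (2 * n))) ⟩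
      ι 4 *√ (ι N *√ ι (4 ^ (2 * n))) ≡⟨ cong (ι 4 *√_) (ι-* N (4 ^ (2 * n))) ⟨
      ι 4 *√ ι (N * 4 ^ (2 * n))   ≡⟨ ι-* 4 (N * 4 ^ (2 * n)) ⟨
      ι M                          ∎
    square : ι 4 *√ u ≡ ι (4 ^ n) *√ (φ *√ φ)
    square = begin
      ι 4 *√ u                     ≡⟨ cong (ι 4 *√_) (trans (cong (λ z → √5+1 ^√ (n + z)) (+-identityʳ n)) (^√-distribˡ-+ √5+1 n n)) ⟩
      ι 2 *√ ι 2 *√ (v *√ v)       ≡⟨ interchange (ι 2) (ι 2) v v ⟩
      ι 2 *√ v *√ (ι 2 *√ v)       ≡⟨ cong₂ _*√_ (√5+1-power k) (√5+1-power k) ⟩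
      ι (2 ^ n) *√ φ *√ (ι (2 ^ n) *√ φ) ≡⟨ interchange (ι (2 ^ n)) φ (ι (2 ^ n)) φ ⟩
      ι (2 ^ n) *√ ι (2 ^ n) *√ (φ *√ φ) ≡⟨ cong (_*√ (φ *√ φ)) (trans (sym (ι-* (2 ^ n) (2 ^ n))) (cong ι (sym (4^n≡2^n*2^n n)))) ⟩
      ι (4 ^ n) *√ (φ *√ φ)        ∎
    right : ι 4 *√ (u *√ ι (p * p)) ≡ ι q *√ (φ *√ φ)
    right = begin
      ι 4 *√ (u *√ ι (p * p))      ≡⟨ *√-assoc (ι 4) u (ι (p * p)) ⟨
      ι 4 *√ u *√ ι (p * p)        ≡⟨ *√-comm (ι 4 *√ u) (ι (p * p)) ⟩
      ι (p * p) *√ (ι 4 *√ u)      ≡⟨ cong (ι (p * p) *√_) square ⟩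
      ι (p * p) *√ (ι (4 ^ n) *√ (φ *√ φ)) ≡⟨ *√-assoc (ι (p * p)) (ι (4 ^ n)) (φ *√ φ) ⟨
      ι (p * p) *√ ι (4 ^ n) *√ (φ *√ φ) ≡⟨ cong (_*√ (φ *√ φ)) (ι-* (p * p) (4 ^ n)) ⟨
      ι q *√ (φ *√ φ)              ∎

  p²≤[2n]³[√5-1]²ⁿ : ι (p * p) ≤√ ι ((2 * n) ^ 3) *√ (√5-1 ^√ (2 * n))
  p²≤[2n]³[√5-1]²ⁿ = NonNeg-cancel-√5+1^ (2 * n) (NonNeg-cancel-ι 4 (subst NonNeg (sym scaled-difference²) NonNeg-E))

theorem5p4 : ∀ (n : ℕ) → 1 ≤ n → ∀ (p : ℕ) → IsOptimalPeggingNumber n p →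
    (√5-1 ^√ n ≤√ ι p)
    × (ι (p * p) ≤√ ι ((2 * n) ^ 3) *√ (√5-1 ^√ (2 * n)))
theorem5p4 n@(suc k) 1≤n p opt@(_ , (D , size≡p , reach) , _) =
  √5-1^n≤p {n} {p} (λ j → subst (λ d → 2 ^ n * fib (suc j + n) ≤ d * fib (suc j + 2 * n)) size≡p
                               (reachesAll⇒size-bound reach j)) ,
  p²≤[2n]³[√5-1]²ⁿ {k} {p} (21[pF]²≤64nB² {n} {p} 1≤n (λ m m≤n → optimal-≤-tilings m 1≤n m≤n opt))
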